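{- Let $L$ be a graph, let $t_1\geq 0$ and $n_0\geq |V(L)|+2t_1$ be integers, and let $r$ and $s$ be real numbers. Suppose that $AR(n,L\cup t_1P_2)\leq (t_1+r)\left(n-\frac{t_1+r+1}{2}\right)+s+1$ for every integer $n\geq n_0$. Then there is a constant $\gamma_2$, depending only on $L$, $t_1$, $r$, $s$ and $n_0$, such that for all integers $t\geq t_1$ and $n>\frac{5}{2}t+\gamma_2$, $$AR(n,L\cup tP_2)\leq (t+r)\left(n-\frac{t+r+1}{2}\right)+s+1.$$
   Context: A subgraph of an edge-coloured graph is multicoloured if all its edges have distinct colours. For a graph $G$ and an integer $n\geq |V(G)|$, $AR(n,G)$ is the minimal integer $r$ such that every edge-colouring of the complete graph $K_n$ using at least $r$ colours contains a multicoloured copy of $G$. $P_m$ denotes the path on $m$ vertices (so $P_2$ is a single edge), $tP_2$ is the disjoint union of $t$ copies of $P_2$ (a matching of size $t$), and $L\cup tP_2$ denotes the vertex-disjoint union of $L$ and $tP_2$. -}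

module Defs where

open import Level using (Level; _⊔_) renaming (suc to lsuc)
open import Data.Bool using (Bool; true; false)
open import Data.Nat using (ℕ; zero; suc; _+_; _≤_)
open import Data.Fin using (Fin; zero; suc; splitAt)
open import Data.Sum using (_⊎_; inj₁; inj₂)
open import Data.Product using (Σ; _×_; _,_; ∃)
open import Relation.Nullary using (¬_)
open import Relation.Binary.PropositionalEquality using (_≡_; refl; _≢_)
open import Relation.Binary.Structures using (IsTotalOrder)
open import Algebra.Structures using (IsCommutativeRing)
open import Function.Definitions using (Injective)

-- Ordered fields (stand-in for ℝ)

record OrderedField (c ℓ₁ ℓ₂ : Level) : Set (lsuc (c ⊔ ℓ₁ ⊔ ℓ₂)) where
  infix  4 _≈_ _≤F_
  infixl 6 _+F_
  infixl 7 _*F_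
  field
    Carrier : Set c
    _≈_     : Carrier → Carrier → Set ℓ₁
    _+F_    : Carrier → Carrier → Carrier
    _*F_    : Carrier → Carrier → Carrier
    -F_     : Carrier → Carrier
    0F      : Carrier
    1F      : Carrier
    _⁻¹     : Carrier → Carrier
    _≤F_    : Carrier → Carrier → Set ℓ₂
    isCommutativeRing : IsCommutativeRing _≈_ _+F_ _*F_ -F_ 0F 1F
    0≉1     : ¬ (0F ≈ 1F)
    ⁻¹-inverse : ∀ x → ¬ (x ≈ 0F) → (x *F (x ⁻¹)) ≈ 1F
    isTotalOrder : IsTotalOrder _≈_ _≤F_
    +-mono-≤ : ∀ {x y} z → x ≤F y → (x +F z) ≤F (y +F z)
    *-nonneg : ∀ {x y} → 0F ≤F x → 0F ≤F y → 0F ≤F (x *F y)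

  _<F_ : Carrier → Carrier → Set (ℓ₁ ⊔ ℓ₂)
  x <F y = (x ≤F y) × ¬ (x ≈ y)

  _-F_ : Carrier → Carrier → Carrier
  x -F y = x +F (-F y)

  fromℕ : ℕ → Carrier
  fromℕ zero    = 0F
  fromℕ (suc n) = 1F +F fromℕ n

  ½ : Carrier
  ½ = (1F +F 1F) ⁻¹

Archimedean : ∀ {c ℓ₁ ℓ₂} → OrderedField c ℓ₁ ℓ₂ → Set (c ⊔ ℓ₂)
Archimedean F = ∀ x → ∃ λ (m : ℕ) → x ≤F fromℕ m
  where open OrderedField F

record Graph : Set where
  field
    size  : ℕ
    adj   : Fin size → Fin size → Bool
    sym   : ∀ u v → adj u v ≡ adj v u
    irrefl : ∀ u → adj u u ≡ false
open Graph public

unionAdj : (G H : Graph) → Fin (size G + size H) → Fin (size G + size H) → Bool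
unionAdj G H x y with splitAt (size G) x | splitAt (size G) y
... | inj₁ a | inj₁ b = adj G a b
... | inj₂ a | inj₂ b = adj H a b
... | inj₁ _ | inj₂ _ = false
... | inj₂ _ | inj₁ _ = false

unionSym : (G H : Graph) → ∀ x y → unionAdj G H x y ≡ unionAdj G H y x
unionSym G H x y with splitAt (size G) x | splitAt (size G) y
... | inj₁ a | inj₁ b = sym G a b
... | inj₂ a | inj₂ b = sym H a b
... | inj₁ _ | inj₂ _ = refl
... | inj₂ _ | inj₁ _ = refl

unionIrrefl : (G H : Graph) → ∀ x → unionAdj G H x x ≡ false
unionIrrefl G H x with splitAt (size G) x
... | inj₁ a = irrefl G a
... | inj₂ a = irrefl H a

_∪G_ : Graph → Graph → Graph
G ∪G H = record
  { size = size G + size H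
  ; adj = unionAdj G H
  ; sym = unionSym G H
  ; irrefl = unionIrrefl G H
  }

K₀ : Graph
K₀ = record { size = 0 ; adj = λ () ; sym = λ () ; irrefl = λ () }

p2adj : Fin 2 → Fin 2 → Bool
p2adj zero (suc zero) = true
p2adj (suc zero) zero = true
p2adj _ _ = false

p2sym : ∀ u v → p2adj u v ≡ p2adj v u
p2sym zero zero = refl
p2sym zero (suc zero) = refl
p2sym (suc zero) zero = refl
p2sym (suc zero) (suc zero) = refl

p2irrefl : ∀ u → p2adj u u ≡ false
p2irrefl zero = refl
p2irrefl (suc zero) = refl

P₂ : Graph
P₂ = record { size = 2 ; adj = p2adj ; sym = p2sym ; irrefl = p2irrefl }

matching : ℕ → Graph
matching zero    = K₀
matching (suc t) = P₂ ∪G matching t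

-- An edge-colouring of K_n using exactly k colours: a symmetric
-- assignment of colours (Fin k) to pairs of distinct vertices
-- (values on the diagonal are irrelevant) in which every colour occurs.
record Colouring (n k : ℕ) : Set where
  field
    col      : Fin n → Fin n → Fin k
    col-sym  : ∀ i j → col i j ≡ col j i
    col-onto : ∀ (a : Fin k) → Σ (Fin n) λ i → Σ (Fin n) λ j → (i ≢ j) × (col i j ≡ a)
open Colouring public

MulticolouredCopy : ∀ {n k} → Graph → Colouring n k → Set
MulticolouredCopy {n} G c =
  Σ (Fin (size G) → Fin n) λ φ →
    Injective _≡_ _≡_ φ ×
    (∀ a b a' b' → adj G a b ≡ true → adj G a' b' ≡ true →
       col c (φ a) (φ b) ≡ col c (φ a') (φ b') →
       ((a ≡ a') × (b ≡ b')) ⊎ ((a ≡ b') × (b ≡ a')))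

ForcesRainbow : ℕ → Graph → ℕ → Set
ForcesRainbow n G r = ∀ k → r ≤ k → (c : Colouring n k) → MulticolouredCopy G c

IsAR : ℕ → Graph → ℕ → Set
IsAR n G a = ForcesRainbow n G a × (∀ r → ForcesRainbow n G r → a ≤ r)

bound : ∀ {c ℓ₁ ℓ₂} (F : OrderedField c ℓ₁ ℓ₂) →
        ℕ → ℕ → OrderedField.Carrier F → OrderedField.Carrier F → OrderedField.Carrier F
bound F t n r s =
  ((fromℕ t +F r) *F (fromℕ n -F ((fromℕ t +F r +F 1F) *F ½))) +F s +F 1F
  where open OrderedField F

ARAtMost : ∀ {c ℓ₁ ℓ₂} (F : OrderedField c ℓ₁ ℓ₂) → ℕ → Graph → OrderedField.Carrier F → Set ℓ₂
ARAtMost F n G x = ∀ a → IsAR n G a → fromℕ a ≤F x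
  where open OrderedField F

{-# OPTIONS --safe #-}
module Submission where

-- Write f(t,n) for the bound; then f(t+1,n+1) = f(t,n) + n, so it suffices to show
-- AR(n+1, L ∪ (t+1)P₂) ≤ max (AR(n, L ∪ tP₂) + n) Q, where Q = 2t² + O(t) does not depend on n.
-- Given a colouring of K_{n+1}, delete a vertex v and merge all colours seen at v into one: at most n
-- colours are lost, so there is a multicoloured H = L ∪ tP₂ missing v that has at most one colour seen
-- at v. If v sees more than |V(H)| + 1 colours, some edge at v extends H. If no vertex sees that many,
-- an augmenting-path argument around H shows that there are fewer than Q colours. The threshold
-- n > 5t/2 + γ₂ is what makes f(t,n) at least Q, provided that t + r ≥ ½ for t > t₁; if this failed, then
-- t₁ + r < 0 and the hypothesis would make AR(n, L ∪ t₁P₂) negative for large n.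

open import Defs
open import Algebra.Bundles using (CommutativeRing)
import Algebra.Solver.Ring
open import Algebra.Solver.Ring.AlmostCommutativeRing using (fromCommutativeRing; _-Raw-AlmostCommutative⟶_)
open import Data.Bool using (true)
open import Data.Bool.Properties using () renaming (_≟_ to _≟ᵇ_)
open import Data.Fin using (Fin; zero; suc; _≟_; splitAt; _↑ˡ_; _↑ʳ_; punchIn; punchOut; combine)
open import Data.Fin.Properties using (any?; all?; splitAt-↑ˡ; splitAt-↑ʳ; splitAt⁻¹-↑ˡ; splitAt⁻¹-↑ʳ; ↑ˡ-injective; ↑ʳ-injective; punchIn-injective; punchInᵢ≢i; punchIn-punchOut; combine-injective; injective⇒≤) renaming (suc-injective to Fin-suc-injective)
open import Data.Integer using (ℤ; -[1+_]; _⊖_) renaming (+_ to pos)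
import Data.Integer as ℤ
import Data.Integer.Properties as ℤₚ
open import Data.List using (List; []; _∷_; _++_; length; map; filter; concatMap; cartesianProduct; cartesianProductWith; allFin) renaming (lookup to lookupList)
open import Data.List.Properties using (length-++; length-map; length-tabulate; length-filter; ++-assoc)
open import Data.List.Membership.Propositional using (_∈_; _∉_; find)
open import Data.List.Membership.DecPropositional using (_∈?_)
open import Data.List.Membership.Propositional.Properties using (∈-map⁺; ∈-map⁻; ∈-filter⁺; ∈-filter⁻; ∈-allFin; ∈-++⁺ˡ; ∈-++⁺ʳ; ∈-++⁻; ∈-∃++; ∈-lookup; ∈-concatMap⁺; ∈-cartesianProduct⁺; ∈-cartesianProductWith⁺)
import Data.List.Relation.Binary.Permutation.Setoid as Permutation
import Data.List.Relation.Binary.Permutation.Setoid.Properties as PermutationProperties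
import Data.List.Relation.Unary.All as All
open import Data.List.Relation.Unary.All using (All; []; _∷_; lookup; tabulate) renaming (map to mapAll; all? to allList?)
open import Data.List.Relation.Unary.All.Properties using (¬All⇒Any¬) renaming (++⁺ to All-++⁺; map⁺ to All-map⁺)
open import Data.List.Relation.Unary.AllPairs using (AllPairs; []; _∷_)
import Data.List.Relation.Unary.Any as Any
open import Data.List.Relation.Unary.Any using (here; there; index)
open import Data.List.Relation.Unary.Unique.Propositional using (Unique)
open import Data.List.Relation.Unary.Unique.Propositional.Properties using (allFin⁺; filter⁺) renaming (map⁺ to Unique-map⁺)
open import Data.Maybe using (Maybe; just; nothing)
open import Data.Nat using (ℕ; zero; suc; _+_; _*_; _≤_; _<_; _⊔_; _≤?_; z≤n; s≤s; s≤s⁻¹)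
import Data.Nat.Properties as ℕₚ
open import Data.Nat.Properties using (suc-injective; <⇒≱; ≰⇒>; ≮⇒≥; _<?_; +-suc; +-monoʳ-≤; +-monoˡ-≤; +-cancelˡ-≤; *-mono-≤; *-monoʳ-≤; *-cancelˡ-≤; n≤1+n; m≤m+n; m≤n+m; m⊔n≤o⇒m≤o; m⊔n≤o⇒n≤o; ⊔-sel; m≤n⇒m<n∨m≡n; m≤n⇒∃[o]m+o≡n; module ≤-Reasoning)
open import Data.Nat.Tactic.RingSolver using (solve-∀)
open import Data.Product using (Σ; ∃; ∃₂; _×_; _,_; proj₁; proj₂; swap) renaming (map to map×)
open import Data.Sum using (_⊎_; inj₁; inj₂; [_,_]′) renaming (map to map⊎)
import Data.Vec as Vec
open import Data.Vec using (Vec; []; _∷_)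
open import Data.Vec.Properties using (lookup∘tabulate)
open import Function using (_∘_; id)
open import Function.Definitions using (Injective)
open import Relation.Binary.Bundles using (Setoid)
open import Relation.Binary.PropositionalEquality using (_≡_; _≢_; refl; trans; cong; cong₂; subst; ≢-sym) renaming (sym to ≡-sym)
open import Relation.Binary.Structures using (IsTotalOrder)
open import Relation.Nullary using (¬_; Dec; yes; no; contradiction)
open import Relation.Nullary.Decidable using (_×-dec_; _⊎-dec_; _→-dec_; ¬?; map′; decidable-stable)
open import Relation.Unary using (Decidable)

-- The constant 5/2: the bound is about tn - t²/2, and it exceeds 2t² once n exceeds 5t/2. The 2t²
-- in turn depends on the merging. H has about 2t vertices and about t colours. Were all its colours
-- possibly seen at v, then v would need about 3t colours before some edge at v is sure to extend H;
-- the count in the remaining case would grow to 3t², and the threshold to 7t/2. With at most one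
-- colour of H seen at v, 2t + O(1) colours suffice. In the remaining case the copy of L stays fixed
-- and only the matching is exchanged. A vertex is big if it has several edges to vertices outside H
-- in colours foreign to H. A matching edge xy with x big can release y, because x can be rematched
-- outside H. An edge in a foreign colour that yields no augmentation therefore meets L, a big end,
-- or a matching edge without big ends, and the edges of these kinds carry few colours.

-- `MulticolouredCopy` for a bare function: the colourings met on the way, restricted to fewer
-- vertices or with colours merged, need not be onto.
Rainbow : ∀ {n K} (G : Graph) (f : Fin n → Fin n → Fin K) → (Fin (size G) → Fin n) → Set
Rainbow G f φ =
  Injective _≡_ _≡_ φ ×
  (∀ a b a' b' → adj G a b ≡ true → adj G a' b' ≡ true →
     f (φ a) (φ b) ≡ f (φ a') (φ b') →
     ((a ≡ a') × (b ≡ b')) ⊎ ((a ≡ b') × (b ≡ a')))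

-- Stands in for function extensionality: embeddings glued along `splitAt` or read off a table agree
-- with the original only pointwise.
Rainbow-resp-≗ : ∀ {n K} (G : Graph) {f : Fin n → Fin n → Fin K} {φ ψ : Fin (size G) → Fin n} →
                 (∀ a → φ a ≡ ψ a) → Rainbow G f φ → Rainbow G f ψ
Rainbow-resp-≗ G {f} eq (inj , rb) =
  (λ {a} {b} e → inj (trans (eq a) (trans e (≡-sym (eq b))))) ,
  (λ a b a' b' p q e → rb a b a' b' p q
    (trans (cong₂ f (eq a) (eq b)) (trans e (≡-sym (cong₂ f (eq a') (eq b'))))))

-- Multicoloured copies of a disjoint union.

module Union (G H : Graph) where

  inl : Fin (size G) → Fin (size G + size H)
  inl = _↑ˡ size H

  inr : Fin (size H) → Fin (size G + size H)
  inr = size G ↑ʳ_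

  inl≢inr : ∀ {a b} → inl a ≢ inr b
  inl≢inr {a} {b} e with trans (≡-sym (splitAt-↑ˡ (size G) a (size H)))
                          (trans (cong (splitAt (size G)) e) (splitAt-↑ʳ (size G) (size H) b))
  ... | ()

  data Side : Fin (size G + size H) → Set where
    left  : ∀ a → Side (inl a)
    right : ∀ b → Side (inr b)

  side : ∀ x → Side x
  side x with splitAt (size G) x in e
  ... | inj₁ a = subst Side (splitAt⁻¹-↑ˡ e) (left a)
  ... | inj₂ b = subst Side (splitAt⁻¹-↑ʳ {size G} {size H} e) (right b)

  adj-ll : ∀ a b → unionAdj G H (inl a) (inl b) ≡ adj G a b
  adj-ll a b rewrite splitAt-↑ˡ (size G) a (size H) | splitAt-↑ˡ (size G) b (size H) = refl

  adj-rr : ∀ a b → unionAdj G H (inr a) (inr b) ≡ adj H a b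
  adj-rr a b rewrite splitAt-↑ʳ (size G) (size H) a | splitAt-↑ʳ (size G) (size H) b = refl

  adj-lr : ∀ a b → unionAdj G H (inl a) (inr b) ≢ true
  adj-lr a b e rewrite splitAt-↑ˡ (size G) a (size H) | splitAt-↑ʳ (size G) (size H) b with e
  ... | ()

  adj-rl : ∀ a b → unionAdj G H (inr a) (inl b) ≢ true
  adj-rl a b e rewrite splitAt-↑ʳ (size G) (size H) a | splitAt-↑ˡ (size G) b (size H) with e
  ... | ()

  module _ {n K : ℕ} (f : Fin n → Fin n → Fin K) where

    VertexDisjoint : (Fin (size G) → Fin n) → (Fin (size H) → Fin n) → Set
    VertexDisjoint φ ψ = ∀ a b → φ a ≢ ψ b

    ColourDisjoint : (Fin (size G) → Fin n) → (Fin (size H) → Fin n) → Set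
    ColourDisjoint φ ψ = ∀ a b a' b' → adj G a b ≡ true → adj H a' b' ≡ true →
                         f (φ a) (φ b) ≢ f (ψ a') (ψ b')

    split-∪ : ∀ {φ} → Rainbow (G ∪G H) f φ →
              Rainbow G f (φ ∘ inl) × Rainbow H f (φ ∘ inr) ×
              VertexDisjoint (φ ∘ inl) (φ ∘ inr) × ColourDisjoint (φ ∘ inl) (φ ∘ inr)
    split-∪ (inj , rb) =
      ((λ e → ↑ˡ-injective (size H) _ _ (inj e)) ,
       (λ a b a' b' p q e → map⊎ (map× (↑ˡ-injective (size H) _ _) (↑ˡ-injective (size H) _ _))
                                 (map× (↑ˡ-injective (size H) _ _) (↑ˡ-injective (size H) _ _))
          (rb (inl a) (inl b) (inl a') (inl b') (trans (adj-ll a b) p) (trans (adj-ll a' b') q) e))) ,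
      ((λ e → ↑ʳ-injective (size G) _ _ (inj e)) ,
       (λ a b a' b' p q e → map⊎ (map× (↑ʳ-injective (size G) _ _) (↑ʳ-injective (size G) _ _))
                                 (map× (↑ʳ-injective (size G) _ _) (↑ʳ-injective (size G) _ _))
          (rb (inr a) (inr b) (inr a') (inr b') (trans (adj-rr a b) p) (trans (adj-rr a' b') q) e))) ,
      (λ a b e → inl≢inr (inj e)) ,
      (λ a b a' b' p q e → [ inl≢inr ∘ proj₁ , inl≢inr ∘ proj₁ ]′
          (rb (inl a) (inl b) (inr a') (inr b') (trans (adj-ll a b) p) (trans (adj-rr a' b') q) e))

    join-∪ : ∀ {φ} → Rainbow G f (φ ∘ inl) → Rainbow H f (φ ∘ inr) →
             VertexDisjoint (φ ∘ inl) (φ ∘ inr) → ColourDisjoint (φ ∘ inl) (φ ∘ inr) →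
             Rainbow (G ∪G H) f φ
    join-∪ {φ} (injG , rbG) (injH , rbH) vd cd = inj , rb
      where
      inj : Injective _≡_ _≡_ φ
      inj {x} {y} e with side x | side y
      ... | left a  | left b  = cong inl (injG e)
      ... | left a  | right b = contradiction e (vd a b)
      ... | right a | left b  = contradiction (≡-sym e) (vd b a)
      ... | right a | right b = cong inr (injH e)
      rb : ∀ a b a' b' → unionAdj G H a b ≡ true → unionAdj G H a' b' ≡ true →
           f (φ a) (φ b) ≡ f (φ a') (φ b') →
           ((a ≡ a') × (b ≡ b')) ⊎ ((a ≡ b') × (b ≡ a'))
      rb a b a' b' p q e with side a | side b | side a' | side b'
      ... | left a  | right b | _        | _        = contradiction p (adj-lr a b)
      ... | right a | left b  | _        | _        = contradiction p (adj-rl a b)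
      ... | _       | _       | left a'  | right b' = contradiction q (adj-lr a' b')
      ... | _       | _       | right a' | left b'  = contradiction q (adj-rl a' b')
      ... | left a  | left b  | left a'  | left b'  =
        map⊎ (map× (cong inl) (cong inl)) (map× (cong inl) (cong inl))
          (rbG a b a' b' (trans (≡-sym (adj-ll a b)) p) (trans (≡-sym (adj-ll a' b')) q) e)
      ... | right a | right b | right a' | right b' =
        map⊎ (map× (cong inr) (cong inr)) (map× (cong inr) (cong inr))
          (rbH a b a' b' (trans (≡-sym (adj-rr a b)) p) (trans (≡-sym (adj-rr a' b')) q) e)
      ... | left a  | left b  | right a' | right b' =
        contradiction e (cd a b a' b' (trans (≡-sym (adj-ll a b)) p) (trans (≡-sym (adj-rr a' b')) q))
      ... | right a | right b | left a'  | left b'  =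
        contradiction (≡-sym e) (cd a' b' a b (trans (≡-sym (adj-ll a' b')) q) (trans (≡-sym (adj-rr a b)) p))

-- Matchings as lists of ordered pairs

Edge : ℕ → Set
Edge n = Fin n × Fin n

pairs : ∀ {n} m → (Fin (size (matching m)) → Fin n) → List (Edge n)
pairs zero    ψ = []
pairs (suc m) ψ = (ψ zero , ψ (suc zero)) ∷ pairs m (λ b → ψ (suc (suc b)))

length-pairs : ∀ {n} m (ψ : Fin (size (matching m)) → Fin n) → length (pairs m ψ) ≡ m
length-pairs zero    ψ = refl
length-pairs (suc m) ψ = cong suc (length-pairs m _)

pairs-surjective : ∀ {n} m (ps : List (Edge n)) → length ps ≡ m → ∃ λ ψ → pairs m ψ ≡ ps
pairs-surjective zero    []             e = (λ ()) , refl
pairs-surjective (suc m) ((x , y) ∷ ps) e with pairs-surjective m ps (suc-injective e)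
... | ψ , eq = (λ { zero → x ; (suc zero) → y ; (suc (suc b)) → ψ b }) , cong ((x , y) ∷_) eq

All-pairs⁺ : ∀ {n} {P : Edge n → Set} m {ψ} →
             (∀ a b → adj (matching m) a b ≡ true → P (ψ a , ψ b)) → All P (pairs m ψ)
All-pairs⁺ zero    h = []
All-pairs⁺ (suc m) h = h zero (suc zero) refl ∷
  All-pairs⁺ m (λ a b p → h (suc (suc a)) (suc (suc b)) (trans (Union.adj-rr P₂ (matching m) a b) p))

-- `adj` holds for both orders of an edge while `pairs` lists only one of them, hence the closure
-- under `swap`.
All-pairs⁻ : ∀ {n} {P : Edge n → Set} → (∀ {e} → P e → P (swap e)) →
             ∀ m {ψ} → All P (pairs m ψ) →
             ∀ a b → adj (matching m) a b ≡ true → P (ψ a , ψ b)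
All-pairs⁻ sw (suc m) (px ∷ pxs) a b e with Union.side P₂ (matching m) a | Union.side P₂ (matching m) b
... | Union.left zero       | Union.left zero       = contradiction (trans (≡-sym (Union.adj-ll P₂ (matching m) zero zero)) e) λ ()
... | Union.left zero       | Union.left (suc zero) = px
... | Union.left (suc zero) | Union.left zero       = sw px
... | Union.left (suc zero) | Union.left (suc zero) = contradiction (trans (≡-sym (Union.adj-ll P₂ (matching m) (suc zero) (suc zero))) e) λ ()
... | Union.left a          | Union.right b         = contradiction e (Union.adj-lr P₂ (matching m) a b)
... | Union.right a         | Union.left b          = contradiction e (Union.adj-rl P₂ (matching m) a b)
... | Union.right a         | Union.right b         =
  All-pairs⁻ sw m pxs a b (trans (≡-sym (Union.adj-rr P₂ (matching m) a b)) e)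

All-pairs-vertices⁺ : ∀ {n} {Q : Fin n → Set} m {ψ} → (∀ a → Q (ψ a)) →
                      All (λ e → Q (proj₁ e) × Q (proj₂ e)) (pairs m ψ)
All-pairs-vertices⁺ m h = All-pairs⁺ m (λ a b _ → h a , h b)

All-pairs-vertices⁻ : ∀ {n} {Q : Fin n → Set} m {ψ} →
                      All (λ e → Q (proj₁ e) × Q (proj₂ e)) (pairs m ψ) → ∀ a → Q (ψ a)
All-pairs-vertices⁻ (suc m) ((p , q) ∷ _) zero          = p
All-pairs-vertices⁻ (suc m) ((p , q) ∷ _) (suc zero)    = q
All-pairs-vertices⁻ (suc m) (_ ∷ pxs)     (suc (suc a)) = All-pairs-vertices⁻ m pxs a

module RainbowMatching {n K : ℕ} (f : Fin n → Fin n → Fin K) (f-sym : ∀ i j → f i j ≡ f j i) where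

  colour : Edge n → Fin K
  colour (x , y) = f x y

  Avoids : Fin n → Edge n → Set
  Avoids v (x , y) = v ≢ x × v ≢ y

  Compatible : Edge n → Edge n → Set
  Compatible (x , y) e = (Avoids x e × Avoids y e) × f x y ≢ colour e

  Proper : Edge n → Set
  Proper (x , y) = x ≢ y

  colour-swap : ∀ e → colour (swap e) ≡ colour e
  colour-swap (x , y) = f-sym y x

  Compatible-swapʳ : ∀ {d e} → Compatible d e → Compatible d (swap e)
  Compatible-swapʳ {d} {e} (((a , b) , (c , g)) , h) =
    ((b , a) , (g , c)) , λ q → h (trans q (colour-swap e))

  pairs-rainbow⁺ : ∀ m {ψ} → Rainbow (matching m) f ψ →
                   All Proper (pairs m ψ) × AllPairs Compatible (pairs m ψ)
  pairs-rainbow⁺ zero    _ = [] , []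
  pairs-rainbow⁺ (suc m) r with Union.split-∪ P₂ (matching m) f r
  ... | r₂ , rm , vd , cd with pairs-rainbow⁺ m rm
  ...   | props , comps =
    (λ e → contradiction (proj₁ r₂ {zero} {suc zero} e) λ ()) ∷ props ,
    All-pairs⁺ m (λ a b p → ((vd zero a , vd zero b) , (vd (suc zero) a , vd (suc zero) b)) ,
                            cd zero (suc zero) a b refl p) ∷ comps

  pairs-rainbow⁻ : ∀ m {ψ} → All Proper (pairs m ψ) → AllPairs Compatible (pairs m ψ) →
                   Rainbow (matching m) f ψ
  pairs-rainbow⁻ zero    _ _ = (λ { {()} }) , (λ ())
  pairs-rainbow⁻ (suc m) {ψ} (p ∷ ps) (c ∷ cs) =
    Union.join-∪ P₂ (matching m) f (inj , rb) (pairs-rainbow⁻ m ps cs) vd cd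
    where
    open Union P₂ (matching m)
    inj : Injective _≡_ _≡_ (ψ ∘ inl)
    inj {zero}     {zero}     _ = refl
    inj {zero}     {suc zero} e = contradiction e p
    inj {suc zero} {zero}     e = contradiction (≡-sym e) p
    inj {suc zero} {suc zero} _ = refl
    rb : ∀ a b a' b' → p2adj a b ≡ true → p2adj a' b' ≡ true →
         f (ψ (inl a)) (ψ (inl b)) ≡ f (ψ (inl a')) (ψ (inl b')) →
         ((a ≡ a') × (b ≡ b')) ⊎ ((a ≡ b') × (b ≡ a'))
    rb zero (suc zero) zero (suc zero) _ _ _ = inj₁ (refl , refl)
    rb zero (suc zero) (suc zero) zero _ _ _ = inj₂ (refl , refl)
    rb (suc zero) zero zero (suc zero) _ _ _ = inj₂ (refl , refl)
    rb (suc zero) zero (suc zero) zero _ _ _ = inj₁ (refl , refl)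
    avoided : ∀ b → ψ zero ≢ ψ (suc (suc b)) × ψ (suc zero) ≢ ψ (suc (suc b))
    avoided = All-pairs-vertices⁻ m (mapAll (λ { (((a , b) , (c , d)) , _) → (a , c) , (b , d) }) c)
    vd : VertexDisjoint f (ψ ∘ inl) (ψ ∘ inr)
    vd zero       b = proj₁ (avoided b)
    vd (suc zero) b = proj₂ (avoided b)
    head≢ : ∀ a' b' → adj (matching m) a' b' ≡ true →
            f (ψ zero) (ψ (suc zero)) ≢ f (ψ (suc (suc a'))) (ψ (suc (suc b')))
    head≢ = All-pairs⁻ {P = λ e → f (ψ zero) (ψ (suc zero)) ≢ colour e}
              (λ {e} h q → h (trans q (colour-swap e))) m (mapAll proj₂ c)
    cd : ColourDisjoint f (ψ ∘ inl) (ψ ∘ inr)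
    cd zero       (suc zero) a' b' _ q e = head≢ a' b' q e
    cd (suc zero) zero       a' b' _ q e = head≢ a' b' q (trans (f-sym _ _) e)

  module Around (FV : List (Fin n)) (FC : List (Fin K)) where

    -- The copy of `L` stays fixed during the exchanges, so it is recorded only as the vertices `FV`
    -- and colours `FC` that matching edges must avoid.
    Allowed : Edge n → Set
    Allowed (x , y) = x ≢ y × (x ∉ FV × y ∉ FV) × f x y ∉ FC

    IsMatching : List (Edge n) → Set
    IsMatching ps = All Allowed ps × AllPairs Compatible ps

  module Copies (L : Graph) where

    vertices : (Fin (size L) → Fin n) → List (Fin n)
    vertices φ = map φ (allFin (size L))

    edges : List (Edge (size L))
    edges = filter (λ e → adj L (proj₁ e) (proj₂ e) ≟ᵇ true) (cartesianProduct (allFin (size L)) (allFin (size L)))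

    colours : (Fin (size L) → Fin n) → List (Fin K)
    colours φ = map (λ e → f (φ (proj₁ e)) (φ (proj₂ e))) edges

    MatchingAround : (Fin (size L) → Fin n) → List (Edge n) → Set
    MatchingAround φ = Around.IsMatching (vertices φ) (colours φ)

    ∈-vertices : ∀ φ a → φ a ∈ vertices φ
    ∈-vertices φ a = ∈-map⁺ φ (∈-allFin a)

    ∈-colours : ∀ φ a b → adj L a b ≡ true → f (φ a) (φ b) ∈ colours φ
    ∈-colours φ a b p = ∈-map⁺ (λ e → f (φ (proj₁ e)) (φ (proj₂ e)))
      (∈-filter⁺ (λ e → adj L (proj₁ e) (proj₂ e) ≟ᵇ true) (∈-cartesianProduct⁺ (∈-allFin a) (∈-allFin b)) p)

    colours⁻ : ∀ φ {x} → x ∈ colours φ → ∃₂ λ a b → adj L a b ≡ true × x ≡ f (φ a) (φ b)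
    colours⁻ φ x∈ with ∈-map⁻ (λ e → f (φ (proj₁ e)) (φ (proj₂ e))) x∈
    ... | (a , b) , e∈ , eq = a , b , proj₂ (∈-filter⁻ (λ e → adj L (proj₁ e) (proj₂ e) ≟ᵇ true)
                                       {xs = cartesianProduct (allFin (size L)) (allFin (size L))} e∈) , eq

    -- Together with `compose`, this reduces enlarging a copy by one more P₂ to lengthening a list
    -- of edges.
    decompose : ∀ m {φ} → Rainbow (L ∪G matching m) f φ →
                Rainbow L f (φ ∘ Union.inl L (matching m)) ×
                MatchingAround (φ ∘ Union.inl L (matching m)) (pairs m (φ ∘ Union.inr L (matching m)))
    decompose m {φ} r with Union.split-∪ L (matching m) f r
    ... | rL , rm , vd , cd with pairs-rainbow⁺ m rm
    ...   | props , comps =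
      rL , All.zipWith (λ (p , q) → p , q) (props , All-pairs⁺ m (λ a b p → (∉V a , ∉V b) , ∉C a b p)) , comps
      where
      open Union L (matching m) using (inl; inr)
      ∉V : ∀ b → φ (inr b) ∉ vertices (φ ∘ inl)
      ∉V b i with ∈-map⁻ (φ ∘ inl) i
      ... | a , _ , e = vd a b (≡-sym e)
      ∉C : ∀ a b → adj (matching m) a b ≡ true → f (φ (inr a)) (φ (inr b)) ∉ colours (φ ∘ inl)
      ∉C a b p i with colours⁻ (φ ∘ inl) i
      ... | a' , b' , q , e = cd a' b' a b q p (≡-sym e)

    compose : ∀ m {φ ps} → Rainbow L f φ → MatchingAround φ ps → length ps ≡ m →
              ∃ λ ψ → Rainbow (L ∪G matching m) f ψ
    compose m {φ} {ps} rL (good , comps) len with pairs-surjective m ps len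
    ... | ψ , refl = χ , join-∪ f {χ} (Rainbow-resp-≗ L {f} (≡-sym ∘ χl) rL)
                           (Rainbow-resp-≗ (matching m) {f} (≡-sym ∘ χr) (pairs-rainbow⁻ m (mapAll proj₁ good) comps))
                           vd cd
      where
      open Union L (matching m)
      χ : Fin (size L + size (matching m)) → Fin n
      χ = [ φ , ψ ]′ ∘ splitAt (size L)
      χl : ∀ a → χ (inl a) ≡ φ a
      χl a = cong [ φ , ψ ]′ (splitAt-↑ˡ (size L) a _)
      χr : ∀ b → χ (inr b) ≡ ψ b
      χr b = cong [ φ , ψ ]′ (splitAt-↑ʳ (size L) _ b)
      ∉V : ∀ b → ψ b ∉ vertices φ
      ∉V = All-pairs-vertices⁻ m (mapAll (λ (_ , v , _) → v) good)
      ∉C : ∀ a b → adj (matching m) a b ≡ true → f (ψ a) (ψ b) ∉ colours φ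
      ∉C = All-pairs⁻ {P = λ e → colour e ∉ colours φ}
             (λ {e} h i → h (subst (_∈ colours φ) (colour-swap e) i)) m (mapAll (λ (_ , _ , c) → c) good)
      vd : VertexDisjoint f (χ ∘ inl) (χ ∘ inr)
      vd a b e = ∉V b (subst (_∈ vertices φ) (trans (≡-sym (χl a)) (trans e (χr b))) (∈-vertices φ a))
      cd : ColourDisjoint f (χ ∘ inl) (χ ∘ inr)
      cd a b a' b' p q e = ∉C a' b' q (subst (_∈ colours φ)
        (trans (≡-sym (cong₂ f (χl a) (χl b))) (trans e (cong₂ f (χr a') (χr b')))) (∈-colours φ a b p))

-- Pigeonhole and length bounds for lists.

module _ {A : Set} where

  Unique-⊆⇒length≤ : ∀ {xs ys : List A} → Unique xs → (∀ {x} → x ∈ xs → x ∈ ys) → length xs ≤ length ys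
  Unique-⊆⇒length≤ []        xs⊆ys = z≤n
  Unique-⊆⇒length≤ {x ∷ xs} (x# ∷ u) xs⊆ys with ∈-∃++ (xs⊆ys (here refl))
  ... | as , bs , refl = subst (suc (length xs) ≤_)
      (trans (cong suc (length-++ as)) (trans (≡-sym (+-suc (length as) (length bs))) (≡-sym (length-++ as))))
      (s≤s (Unique-⊆⇒length≤ u xs⊆as++bs))
    where
    xs⊆as++bs : ∀ {z} → z ∈ xs → z ∈ as ++ bs
    xs⊆as++bs z∈ with ∈-++⁻ as (xs⊆ys (there z∈))
    ... | inj₁ i           = ∈-++⁺ˡ i
    ... | inj₂ (here refl) = contradiction refl (lookup x# z∈)
    ... | inj₂ (there i)   = ∈-++⁺ʳ as i

  length-concatMap-≤ : ∀ {B : Set} (g : A → List B) {d xs} → All (λ x → length (g x) ≤ d) xs →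
                       length (concatMap g xs) ≤ length xs * d
  length-concatMap-≤ g []                = z≤n
  length-concatMap-≤ g (_∷_ {x = x} h hs) = ℕₚ.≤-trans (ℕₚ.≤-reflexive (length-++ (g x)))
                                             (ℕₚ.+-mono-≤ h (length-concatMap-≤ g hs))

  length-cartesianProductWith : ∀ {B C : Set} (g : A → B → C) xs ys →
                                length (cartesianProductWith g xs ys) ≡ length xs * length ys
  length-cartesianProductWith g []       ys = refl
  length-cartesianProductWith g (x ∷ xs) ys =
    trans (length-++ (map (g x) ys)) (cong₂ _+_ (length-map (g x) ys) (length-cartesianProductWith g xs ys))

∃-avoiding : ∀ {K} {xs : List (Fin K)} (ys : List (Fin K)) → Unique xs → length ys < length xs →
             ∃ λ x → x ∈ xs × x ∉ ys
∃-avoiding {_} {xs} ys u lt with allList? (λ x → _∈?_ _≟_ x ys) xs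
... | yes all = contradiction (Unique-⊆⇒length≤ u (lookup all)) (<⇒≱ lt)
... | no ¬all with find (¬All⇒Any¬ (λ x → _∈?_ _≟_ x ys) xs ¬all)
...   | x , x∈ , x∉ = x , x∈ , x∉

∀∈⇒≤length : ∀ {K} {xs : List (Fin K)} → (∀ a → a ∈ xs) → K ≤ length xs
∀∈⇒≤length {K} {xs} all = subst (_≤ length xs) (length-tabulate {n = K} id) (Unique-⊆⇒length≤ (allFin⁺ K) (λ {x} _ → all x))

-- Augmenting the matching and counting colours.

module _ (n : ℕ) where

  -- Permutations up to reversal of edges allow the big end of a matching edge to be moved to the
  -- first coordinate.
  _≈ₑ_ : Edge n → Edge n → Set
  d ≈ₑ e = d ≡ e ⊎ d ≡ swap e

  unorderedEdges : Setoid _ _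
  unorderedEdges = record
    { Carrier = Edge n
    ; _≈_ = _≈ₑ_
    ; isEquivalence = record
      { refl = inj₁ refl
      ; sym = λ { (inj₁ refl) → inj₁ refl ; (inj₂ refl) → inj₂ refl }
      ; trans = λ { (inj₁ refl) q → q ; (inj₂ refl) (inj₁ refl) → inj₂ refl ; (inj₂ refl) (inj₂ refl) → inj₁ refl }
      }
    }

-- Bounds the number of colours when a graph on ℓ vertices with at most e edges plus m matching edges
-- cannot be extended and every vertex sees at most ℓ + 2m + 1 colours. Of the m matching edges, let b
-- have a big end; the count in countBound-dominates depends on b only through terms linear in m.
countBound : ℕ → ℕ → ℕ → ℕ
countBound ℓ e m = e + m + ℓ * (ℓ + 2 * m + 1) + (ℓ + 1) * m + 2 * (m * m) + 6 * m

-- The quadratic parts are 2b(b + s) from the colours at big ends, 2bs from partners against others,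
-- and 2s² among others. They sum to 2(b + s)² however the matching splits.
countBound-dominates : ∀ ℓ e b s {u} → 2 * u ≤ (s + s) * (s + s) →
  e + ((b + s) + ((ℓ + b) * (ℓ + 2 * (b + s) + 1) + ((s + s) * 3 + (b * (s + s) + u)))) ≤ countBound ℓ e (b + s)
countBound-dominates ℓ e b s {u} 2u≤ = begin
  e + ((b + s) + ((ℓ + b) * (ℓ + 2 * (b + s) + 1) + ((s + s) * 3 + (b * (s + s) + u))))
    ≤⟨ +-monoʳ-≤ e (+-monoʳ-≤ (b + s) (+-monoʳ-≤ ((ℓ + b) * (ℓ + 2 * (b + s) + 1)) (+-monoʳ-≤ ((s + s) * 3) (+-monoʳ-≤ (b * (s + s)) u≤)))) ⟩
  e + ((b + s) + ((ℓ + b) * (ℓ + 2 * (b + s) + 1) + ((s + s) * 3 + (b * (s + s) + 2 * (s * s)))))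
    -- An edge with a big end has the further cost ℓ + 1 and one without has cost 6. Charging both
    -- costs to every edge removes the dependence on b.
    ≤⟨ m≤m+n _ ((ℓ + 1) * s + 6 * b) ⟩
  e + ((b + s) + ((ℓ + b) * (ℓ + 2 * (b + s) + 1) + ((s + s) * 3 + (b * (s + s) + 2 * (s * s))))) + ((ℓ + 1) * s + 6 * b)
    ≡⟨ identity ℓ e b s ⟩
  countBound ℓ e (b + s) ∎
  where
  open ≤-Reasoning
  double : ∀ s → (s + s) * (s + s) ≡ 2 * (2 * (s * s))
  double = solve-∀
  u≤ : u ≤ 2 * (s * s)
  u≤ = *-cancelˡ-≤ 2 (ℕₚ.≤-trans 2u≤ (ℕₚ.≤-reflexive (double s)))
  identity : ∀ ℓ e b s →
    e + ((b + s) + ((ℓ + b) * (ℓ + 2 * (b + s) + 1) + ((s + s) * 3 + (b * (s + s) + 2 * (s * s))))) + ((ℓ + 1) * s + 6 * b)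
    ≡ e + (b + s) + ℓ * (ℓ + 2 * (b + s) + 1) + (ℓ + 1) * (b + s) + 2 * ((b + s) * (b + s)) + 6 * (b + s)
  identity = solve-∀

module Augment {n K : ℕ} (f : Fin n → Fin n → Fin K) (f-sym : ∀ i j → f i j ≡ f j i)
               (FV : List (Fin n)) (FC : List (Fin K)) where

  open RainbowMatching f f-sym
  open Around FV FC
  open Permutation (unorderedEdges n) using (_↭_; prep; ↭-refl; ↭-sym; ↭-trans)
  private module ↭ = PermutationProperties (unorderedEdges n)

  colourOf-resp : ∀ {d e} → _≈ₑ_ n d e → colour d ≡ colour e
  colourOf-resp (inj₁ refl) = refl
  colourOf-resp {e = e} (inj₂ refl) = colour-swap e

  Free : Fin n → List (Edge n) → Set
  Free v ps = v ∉ FV × All (Avoids v) ps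

  New : Fin K → List (Edge n) → Set
  New a ps = a ∉ FC × All (λ e → a ≢ colour e) ps

  Free? : ∀ ps → Decidable (λ v → Free v ps)
  Free? ps v = ¬? (_∈?_ _≟_ v FV) ×-dec allList? (λ e → ¬? (v ≟ proj₁ e) ×-dec ¬? (v ≟ proj₂ e)) ps

  New? : ∀ ps → Decidable (λ a → New a ps)
  New? ps a = ¬? (_∈?_ _≟_ a FC) ×-dec allList? (λ e → ¬? (a ≟ colour e)) ps

  cons-matching : ∀ {x y ps} → x ≢ y → Free x ps → Free y ps → New (f x y) ps →
                  IsMatching ps → IsMatching ((x , y) ∷ ps)
  cons-matching x≢y (x∉ , xs) (y∉ , ys) (c∉ , cs) (al , ap) =
    (x≢y , (x∉ , y∉) , c∉) ∷ al , All.zip (All.zip (xs , ys) , cs) ∷ ap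

  uncons-matching : ∀ {x y ps} → IsMatching ((x , y) ∷ ps) →
                    x ≢ y × Free x ps × Free y ps × New (f x y) ps × IsMatching ps
  uncons-matching ((x≢y , (x∉ , y∉) , c∉) ∷ al , cp ∷ ap) =
    x≢y , (x∉ , mapAll (proj₁ ∘ proj₁) cp) , (y∉ , mapAll (proj₂ ∘ proj₁) cp) , (c∉ , mapAll proj₂ cp) , al , ap

  Free-resp-↭ : ∀ {v ps qs} → ps ↭ qs → Free v ps → Free v qs
  Free-resp-↭ p (v∉ , vs) = v∉ , ↭.All-resp-↭ (λ { (inj₁ refl) h → h ; (inj₂ refl) h → swap h }) p vs

  New-resp-↭ : ∀ {a ps qs} → ps ↭ qs → New a ps → New a qs
  New-resp-↭ p (a∉ , as) = a∉ , ↭.All-resp-↭ (λ d≈e h eq → h (trans eq (≡-sym (colourOf-resp d≈e)))) p as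

  IsMatching-resp-↭ : ∀ {ps qs} → ps ↭ qs → IsMatching ps → IsMatching qs
  IsMatching-resp-↭ p (al , ap) =
    ↭.All-resp-↭ allowed-resp p al , ↭.AllPairs-resp-↭ (λ {d} {e} → compatible-sym {d} {e}) (respʳ , respˡ) p ap
    where
    allowed-resp : ∀ {d e} → _≈ₑ_ n d e → Allowed d → Allowed e
    allowed-resp (inj₁ refl) h = h
    allowed-resp {e = e} (inj₂ refl) (x≢y , v∉ , c∉) = ≢-sym x≢y , swap v∉ , λ i → c∉ (subst (_∈ FC) (≡-sym (colour-swap e)) i)
    compatible-sym : ∀ {d e} → Compatible d e → Compatible e d
    compatible-sym (((a , b) , (c , g)) , h) = ((≢-sym a , ≢-sym c) , (≢-sym b , ≢-sym g)) , ≢-sym h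
    respʳ : ∀ {d e e'} → _≈ₑ_ n e e' → Compatible d e → Compatible d e'
    respʳ (inj₁ refl) h = h
    respʳ {d} {e' = e'} (inj₂ refl) h = Compatible-swapʳ {d} {swap e'} h
    respˡ : ∀ {d e e'} → _≈ₑ_ n e e' → Compatible e d → Compatible e' d
    respˡ {d} {e} {e'} q h = compatible-sym {d} {e'} (respʳ {d} {e} {e'} q (compatible-sym {e} {d} h))

  splitBy : ∀ {B : Fin n → Set} → Decidable B → ∀ ps → ∃₂ λ bs ss →
            ps ↭ bs ++ ss × All (B ∘ proj₁) bs × All (λ e → ¬ B (proj₁ e) × ¬ B (proj₂ e)) ss
  splitBy B? [] = [] , [] , ↭-refl , [] , []
  splitBy B? ((x , y) ∷ ps) with splitBy B? ps
  ... | bs , ss , p , hb , hs with B? x | B? y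
  ...   | yes bx | _      = (x , y) ∷ bs , ss , prep (inj₁ refl) p , bx ∷ hb , hs
  ...   | no  _  | yes by = (y , x) ∷ bs , ss , prep (inj₂ refl) p , by ∷ hb , hs
  ...   | no ¬bx | no ¬by = bs , (x , y) ∷ ss ,
            ↭-trans (prep (inj₁ refl) p) (↭-sym (↭.shift (inj₁ refl) bs ss)) , hb , (¬bx , ¬by) ∷ hs

  -- The last component lets a second edge be extracted from the remainder, as `partner-partner`
  -- requires.
  extract : ∀ {e} {bs : List (Edge n)} → e ∈ bs → ∀ ss →
            ∃ λ cs → bs ++ ss ↭ e ∷ cs ++ ss × (∀ {d} → d ∈ bs → d ≢ e → d ∈ cs)
  extract {e} e∈ ss with ∈-∃++ e∈
  ... | as , cs , refl = as ++ cs ,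
        subst (λ l → (as ++ e ∷ cs) ++ ss ↭ e ∷ l) (≡-sym (++-assoc as cs ss))
          (subst (_↭ e ∷ as ++ cs ++ ss) (≡-sym (++-assoc as (e ∷ cs) ss)) (↭.shift (inj₁ refl) as (cs ++ ss))) ,
        other
    where
    other : ∀ {d} → d ∈ as ++ e ∷ cs → d ≢ e → d ∈ as ++ cs
    other d∈ d≢ with ∈-++⁻ as d∈
    ... | inj₁ i           = ∈-++⁺ˡ i
    ... | inj₂ (here refl) = contradiction refl d≢
    ... | inj₂ (there i)   = ∈-++⁺ʳ as i

  module _ (ps : List (Edge n)) where

    newAt : Fin n → List (Fin K)
    newAt s = filter (λ a → New? ps a ×-dec any? (λ w → Free? ps w ×-dec (f s w ≟ a))) (allFin K)

    -- Four, because the augmentations below have to avoid up to three colours at a big vertex.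
    Big : Fin n → Set
    Big s = 4 ≤ length (newAt s)

    newAt⁺ : ∀ {s w} → Free w ps → New (f s w) ps → f s w ∈ newAt s
    newAt⁺ fr nw = ∈-filter⁺ _ (∈-allFin _) (nw , _ , fr , refl)

    -- Forbidden colours also serve to forbid vertices: if `f s v` belongs to `cs`, then the vertex
    -- found differs from `v`.
    Big-avoiding : ∀ {s} → Big s → (cs : List (Fin K)) → length cs ≤ 3 →
                   ∃ λ w → Free w ps × New (f s w) ps × f s w ∉ cs
    Big-avoiding {s} big cs len with ∃-avoiding cs (filter⁺ _ (allFin⁺ K)) (ℕₚ.≤-trans (s≤s len) big)
    ... | a , a∈ , a∉ with ∈-filter⁻ (λ a → New? ps a ×-dec any? (λ w → Free? ps w ×-dec (f s w ≟ a))) {xs = allFin K} a∈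
    ...   | _ , nw , w , fr , refl = w , fr , nw , a∉

    Extension : Set
    Extension = ∃ λ qs → IsMatching qs × length qs ≡ suc (length ps)

    augment₀ : IsMatching ps → ∀ {v w} → v ≢ w → Free v ps → Free w ps → New (f v w) ps → Extension
    augment₀ M v≢w fv fw nw = _ , cons-matching v≢w fv fw nw M , refl

    -- Alternating path w, y, x, v: the edge xy leaves the matching, yw and xv enter.
    augment₁ : IsMatching ps → ∀ {x y qs} → ps ↭ (x , y) ∷ qs → Big x →
               ∀ {w} → Free w ps → New (f y w) ps → Extension
    augment₁ M {x} {y} {qs} p big {w} fw nw
      -- Avoiding `f y w` keeps the two entering colours distinct; avoiding `f x w` keeps `v`
      -- distinct from `w`.
      with Big-avoiding big (f y w ∷ f x w ∷ []) (s≤s (s≤s z≤n))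
    ... | v , fv , nv , avoid
      with uncons-matching (IsMatching-resp-↭ p M)
         | Free-resp-↭ p fw | Free-resp-↭ p fv | New-resp-↭ p nw | New-resp-↭ p nv
    ...   | x≢y , (x∉ , xs) , fy , _ , Mq
          | w∉ , (w≢x , w≢y) ∷ ws | v∉ , (v≢x , v≢y) ∷ vs | c∉ , _ ∷ cs | d∉ , _ ∷ ds =
      (x , v) ∷ (y , w) ∷ qs ,
      cons-matching (≢-sym v≢x)
        (x∉ , (x≢y , ≢-sym w≢x) ∷ xs)
        (v∉ , (v≢y , λ { refl → avoid (there (here refl)) }) ∷ vs)
        (d∉ , (λ eq → avoid (here eq)) ∷ ds)
        (cons-matching (≢-sym w≢y) fy (w∉ , ws) (c∉ , cs) Mq) ,
      cong suc (≡-sym (↭.xs↭ys⇒|xs|≡|ys| p))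

    -- Alternating path v, x, y, y', x', v': the edges xy and x'y' leave the matching, xv, yy' and
    -- x'v' enter.
    augment₂ : IsMatching ps → ∀ {x y x' y' qs} → ps ↭ (x , y) ∷ (x' , y') ∷ qs → Big x → Big x' →
               New (f y y') ps → Extension
    augment₂ M {x} {y} {x'} {y'} {qs} p big big' nw
      with Big-avoiding big (f y y' ∷ []) (s≤s z≤n)
    ... | v , fv , nv , avoid
      -- The first two are the colours of the other entering edges; `f x' v` forces `v'` to differ
      -- from `v`.
      with Big-avoiding big' (f y y' ∷ f x v ∷ f x' v ∷ []) (s≤s (s≤s (s≤s z≤n)))
    ...   | v' , fv' , nv' , avoid'
      with uncons-matching (IsMatching-resp-↭ p M)
    ...     | x≢y , (x∉ , (x≢x' , x≢y') ∷ xs) , (y∉ , (y≢x' , y≢y') ∷ ys) , _ , Mp'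
      with uncons-matching Mp'
         | Free-resp-↭ p fv | Free-resp-↭ p fv' | New-resp-↭ p nw | New-resp-↭ p nv | New-resp-↭ p nv'
    ...       | x'≢y' , (x'∉ , xs') , fy' , _ , Mq
              | v∉ , (v≢x , v≢y) ∷ (v≢x' , v≢y') ∷ vs | v'∉ , (v'≢x , v'≢y) ∷ (v'≢x' , v'≢y') ∷ vs'
              | c∉ , _ ∷ _ ∷ cs | d∉ , _ ∷ _ ∷ ds | d'∉ , _ ∷ _ ∷ ds' =
      (x , v) ∷ (x' , v') ∷ (y , y') ∷ qs ,
      cons-matching (≢-sym v≢x)
        (x∉ , (x≢x' , ≢-sym v'≢x) ∷ (x≢y , x≢y') ∷ xs)
        (v∉ , (v≢x' , λ { refl → avoid' (there (there (here refl))) }) ∷ (v≢y , v≢y') ∷ vs)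
        (d∉ , (λ eq → avoid' (there (here (≡-sym eq)))) ∷ (λ eq → avoid (here eq)) ∷ ds)
        (cons-matching (≢-sym v'≢x')
          (x'∉ , (≢-sym y≢x' , x'≢y') ∷ xs')
          (v'∉ , (v'≢y , v'≢y') ∷ vs')
          (d'∉ , (λ eq → avoid' (here eq)) ∷ ds')
          (cons-matching y≢y' (y∉ , ys) fy' (c∉ , cs) Mq)) ,
      cong suc (≡-sym (↭.xs↭ys⇒|xs|≡|ys| p))

  coloursAt : Fin n → List (Fin K)
  coloursAt v = filter (λ a → any? (λ w → ¬? (v ≟ w) ×-dec (f v w ≟ a))) (allFin K)

  ∈-coloursAt : ∀ {v w} → v ≢ w → f v w ∈ coloursAt v
  ∈-coloursAt v≢w = ∈-filter⁺ _ (∈-allFin _) (_ , v≢w , refl)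

  coloursBetween : List (Fin n) → List (Fin K)
  coloursBetween []       = []
  coloursBetween (v ∷ vs) = map (f v) vs ++ coloursBetween vs

  ∈-coloursBetween : ∀ {v w vs} → v ∈ vs → w ∈ vs → v ≢ w → f v w ∈ coloursBetween vs
  ∈-coloursBetween (here refl) (here refl) v≢w = contradiction refl v≢w
  ∈-coloursBetween (here refl) (there w∈)  v≢w = ∈-++⁺ˡ (∈-map⁺ (f _) w∈)
  ∈-coloursBetween {v} {w} {vs = _ ∷ vs} (there v∈) (here refl) v≢w =
    ∈-++⁺ˡ (subst (_∈ map (f w) vs) (f-sym w v) (∈-map⁺ (f w) v∈))
  ∈-coloursBetween {vs = u ∷ vs} (there v∈) (there w∈) v≢w = ∈-++⁺ʳ (map (f u) vs) (∈-coloursBetween v∈ w∈ v≢w)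

  -- Each unordered pair is visited once. The factor 2 gained turns the (2s)² ordered pairs of
  -- others into the 2s² on which the colour count relies.
  length-coloursBetween : ∀ vs → 2 * length (coloursBetween vs) ≤ length vs * length vs
  length-coloursBetween []       = z≤n
  length-coloursBetween (v ∷ vs) = begin
    2 * length (map (f v) vs ++ coloursBetween vs)      ≡⟨ cong (2 *_) (trans (length-++ (map (f v) vs)) (cong (_+ length (coloursBetween vs)) (length-map (f v) vs))) ⟩
    2 * (length vs + length (coloursBetween vs))        ≡⟨ distrib (length vs) (length (coloursBetween vs)) ⟩
    2 * length vs + 2 * length (coloursBetween vs)      ≤⟨ +-monoʳ-≤ (2 * length vs) (length-coloursBetween vs) ⟩
    2 * length vs + length vs * length vs               ≤⟨ m≤m+n _ 1 ⟩
    2 * length vs + length vs * length vs + 1           ≡⟨ square (length vs) ⟩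
    suc (length vs) * suc (length vs)                   ∎
    where
    open ≤-Reasoning
    distrib : ∀ a b → 2 * (a + b) ≡ 2 * a + 2 * b
    distrib = solve-∀
    square : ∀ a → 2 * a + a * a + 1 ≡ suc a * suc a
    square = solve-∀

  module Count (ps : List (Edge n)) (M : IsMatching ps) (bs ss : List (Edge n)) (ps↭ : ps ↭ bs ++ ss)
               (bigs : All (Big ps ∘ proj₁) bs)
               (smalls : All (λ e → ¬ Big ps (proj₁ e) × ¬ Big ps (proj₂ e)) ss) where

    centres partners others : List (Fin n)
    centres  = map proj₁ bs
    partners = map proj₂ bs
    others   = map proj₁ ss ++ map proj₂ ss

    -- One segment for each way in which an edge can escape the augmentations: its colour already
    -- occurs in the copy of `L` or in the matching, it meets a hub, or it joins an other to a free
    -- vertex, to a partner or to another other.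
    listed : List (Fin K)
    listed = FC ++ map colour ps ++ concatMap coloursAt (FV ++ centres) ++ concatMap (newAt ps) others
             ++ cartesianProductWith f partners others ++ coloursBetween others

    length-listed : ∀ {e} → length FC ≤ e →
                    (∀ v → length (coloursAt v) ≤ length FV + 2 * length ps + 1) →
                    length listed ≤ countBound (length FV) e (length ps)
    length-listed {e} FC≤ deg≤ = subst (λ m → length listed ≤ countBound (length FV) e m) (≡-sym |ps|) (begin
      length listed
        ≡⟨ trans (length-++ FC) (cong (length FC +_) (trans (length-++ (map colour ps)) (cong₂ _+_ (length-map colour ps)
            (trans (length-++ (concatMap coloursAt (FV ++ centres))) (cong (length (concatMap coloursAt (FV ++ centres)) +_)
            (trans (length-++ (concatMap (newAt ps) others)) (cong (length (concatMap (newAt ps) others) +_)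
            (length-++ (cartesianProductWith f partners others))))))))) ⟩
      length FC + (length ps + (length (concatMap coloursAt (FV ++ centres)) + (length (concatMap (newAt ps) others)
        + (length (cartesianProductWith f partners others) + length (coloursBetween others)))))
        ≤⟨ ℕₚ.+-mono-≤ FC≤ (ℕₚ.+-mono-≤ (ℕₚ.≤-reflexive |ps|) (ℕₚ.+-mono-≤ atHubs (ℕₚ.+-mono-≤ atOthers (ℕₚ.+-mono-≤ (ℕₚ.≤-reflexive between) ℕₚ.≤-refl)))) ⟩
      e + ((b + s) + ((length FV + b) * (length FV + 2 * (b + s) + 1) + ((s + s) * 3 + (b * (s + s) + length (coloursBetween others)))))
        ≤⟨ countBound-dominates (length FV) e b s (subst (λ l → 2 * length (coloursBetween others) ≤ l * l) |others| (length-coloursBetween others)) ⟩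
      countBound (length FV) e (b + s) ∎)
      where
      open ≤-Reasoning
      b s : ℕ
      b = length bs
      s = length ss
      |ps| : length ps ≡ b + s
      |ps| = trans (↭.xs↭ys⇒|xs|≡|ys| ps↭) (length-++ bs)
      |others| : length others ≡ s + s
      |others| = trans (length-++ (map proj₁ ss)) (cong₂ _+_ (length-map proj₁ ss) (length-map proj₂ ss))
      atHubs : length (concatMap coloursAt (FV ++ centres)) ≤ (length FV + b) * (length FV + 2 * (b + s) + 1)
      atHubs = ℕₚ.≤-trans (length-concatMap-≤ coloursAt {xs = FV ++ centres} (tabulate (λ {v} _ → deg≤ v)))
                 (ℕₚ.≤-reflexive (cong₂ _*_ (trans (length-++ FV {centres}) (cong (length FV +_) (length-map proj₁ bs)))
                                         (cong (λ m → length FV + 2 * m + 1) |ps|)))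
      atOthers : length (concatMap (newAt ps) others) ≤ (s + s) * 3
      atOthers = ℕₚ.≤-trans (length-concatMap-≤ (newAt ps)
                   (mapAll (λ ¬big → s≤s⁻¹ (≰⇒> ¬big)) (All-++⁺ (All-map⁺ (mapAll proj₁ smalls)) (All-map⁺ (mapAll proj₂ smalls)))))
                   (ℕₚ.≤-reflexive (cong (_* 3) |others|))
      between : length (cartesianProductWith f partners others) ≡ b * (s + s)
      between = trans (length-cartesianProductWith f partners others) (cong₂ _*_ (length-map proj₂ bs) |others|)

    -- Hubs lie in L or are big ends of matching edges, partners are matched to a big end, others are the
    -- ends of matching edges without a big end.
    data Position (v : Fin n) : Set where
      hub     : v ∈ FV ++ centres → Position v
      partner : v ∈ partners → Position v
      other   : v ∈ others → Position v
      free    : Free v ps → Position v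

    position : ∀ v → Position v
    position v with _∈?_ _≟_ v (FV ++ centres) | _∈?_ _≟_ v partners | _∈?_ _≟_ v others
    ... | yes v∈ | _      | _      = hub v∈
    ... | no _   | yes v∈ | _      = partner v∈
    ... | no _   | no _   | yes v∈ = other v∈
    ... | no v∉h | no v∉p | no v∉o = free (Free-resp-↭ (↭-sym ps↭)
      ((v∉h ∘ ∈-++⁺ˡ) ,
       All-++⁺ (tabulate λ e∈ → (λ { refl → v∉h (∈-++⁺ʳ FV (∈-map⁺ proj₁ e∈)) }) ,
                                (λ { refl → v∉p (∈-map⁺ proj₂ e∈) }))
               (tabulate λ e∈ → (λ { refl → v∉o (∈-++⁺ˡ (∈-map⁺ proj₁ e∈)) }) ,
                                (λ { refl → v∉o (∈-++⁺ʳ (map proj₁ ss) (∈-map⁺ proj₂ e∈)) }))))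

    listed-hub : ∀ {v w} → v ∈ FV ++ centres → v ≢ w → f v w ∈ listed
    listed-hub v∈ v≢w = ∈-++⁺ʳ FC (∈-++⁺ʳ (map colour ps) (∈-++⁺ˡ
      (∈-concatMap⁺ coloursAt (Any.map (λ { refl → ∈-coloursAt v≢w }) v∈))))

    listed-other-free : ∀ {v w} → v ∈ others → Free w ps → New (f v w) ps → f v w ∈ listed
    listed-other-free v∈ fw nw = ∈-++⁺ʳ FC (∈-++⁺ʳ (map colour ps) (∈-++⁺ʳ (concatMap coloursAt (FV ++ centres)) (∈-++⁺ˡ
      (∈-concatMap⁺ (newAt ps) (Any.map (λ { refl → newAt⁺ ps fw nw }) v∈)))))

    listed-partner-other : ∀ {v w} → v ∈ partners → w ∈ others → f v w ∈ listed
    listed-partner-other v∈ w∈ = ∈-++⁺ʳ FC (∈-++⁺ʳ (map colour ps) (∈-++⁺ʳ (concatMap coloursAt (FV ++ centres))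
      (∈-++⁺ʳ (concatMap (newAt ps) others) (∈-++⁺ˡ (∈-cartesianProductWith⁺ f v∈ w∈)))))

    listed-others : ∀ {v w} → v ∈ others → w ∈ others → v ≢ w → f v w ∈ listed
    listed-others v∈ w∈ v≢w = ∈-++⁺ʳ FC (∈-++⁺ʳ (map colour ps) (∈-++⁺ʳ (concatMap coloursAt (FV ++ centres))
      (∈-++⁺ʳ (concatMap (newAt ps) others) (∈-++⁺ʳ (cartesianProductWith f partners others) (∈-coloursBetween v∈ w∈ v≢w)))))

    partner-free : ∀ {v w} → v ∈ partners → Free w ps → New (f v w) ps → Extension ps
    partner-free v∈ fw nw with ∈-map⁻ proj₂ v∈
    ... | (x , v) , e∈ , refl with extract e∈ ss
    ...   | cs , p , _ = augment₁ ps M (↭-trans ps↭ p) (lookup bigs e∈) fw nw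

    partner-partner : ∀ {v w} → v ∈ partners → w ∈ partners → v ≢ w → New (f v w) ps → Extension ps
    partner-partner v∈ w∈ v≢w nw with ∈-map⁻ proj₂ v∈ | ∈-map⁻ proj₂ w∈
    ... | (x , v) , d∈ , refl | (x' , w) , e∈ , refl with extract d∈ ss
    ...   | cs , p , rest with extract (rest e∈ (λ { refl → v≢w refl })) ss
    ...     | cs' , q , _ = augment₂ ps M (↭-trans ps↭ (↭-trans p (prep (inj₁ refl) q))) (lookup bigs d∈) (lookup bigs e∈) nw

    -- For a new colour, the positions involving neither a hub nor an other are free-free,
    -- partner-free and partner-partner; `augment₀`, `augment₁` and `augment₂` settle exactly these.
    listed-or-extension : ∀ {v w} → v ≢ w → f v w ∈ listed ⊎ Extension ps
    listed-or-extension {v} {w} v≢w with New? ps (f v w)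
    ... | no ¬nw = inj₁ (old ¬nw)
      where
      old : ∀ {a} → ¬ New a ps → a ∈ listed
      old {a} ¬nw with _∈?_ _≟_ a FC | _∈?_ _≟_ a (map colour ps)
      ... | yes a∈ | _      = ∈-++⁺ˡ a∈
      ... | no  _  | yes a∈ = ∈-++⁺ʳ FC (∈-++⁺ˡ a∈)
      ... | no a∉  | no a∉' = contradiction (a∉ , tabulate λ e∈ → λ { refl → a∉' (∈-map⁺ colour e∈) }) ¬nw
    ... | yes nw = cases (position v) (position w)
      where
      flip-listed : f w v ∈ listed → f v w ∈ listed
      flip-listed = subst (_∈ listed) (f-sym w v)
      wn : New (f w v) ps
      wn = subst (λ a → New a ps) (f-sym v w) nw
      cases : Position v → Position w → f v w ∈ listed ⊎ Extension ps
      cases (hub v∈)     _            = inj₁ (listed-hub v∈ v≢w)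
      cases (partner v∈) (hub w∈)     = inj₁ (flip-listed (listed-hub w∈ (≢-sym v≢w)))
      cases (partner v∈) (partner w∈) = inj₂ (partner-partner v∈ w∈ v≢w nw)
      cases (partner v∈) (other w∈)   = inj₁ (listed-partner-other v∈ w∈)
      cases (partner v∈) (free fw)    = inj₂ (partner-free v∈ fw nw)
      cases (other v∈)   (hub w∈)     = inj₁ (flip-listed (listed-hub w∈ (≢-sym v≢w)))
      cases (other v∈)   (partner w∈) = inj₁ (flip-listed (listed-partner-other w∈ v∈))
      cases (other v∈)   (other w∈)   = inj₁ (listed-others v∈ w∈ v≢w)
      cases (other v∈)   (free fw)    = inj₁ (listed-other-free v∈ fw nw)
      cases (free fv)    (hub w∈)     = inj₁ (flip-listed (listed-hub w∈ (≢-sym v≢w)))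
      cases (free fv)    (partner w∈) = inj₂ (partner-free w∈ fv wn)
      cases (free fv)    (other w∈)   = inj₁ (flip-listed (listed-other-free w∈ fv wn))
      cases (free fv)    (free fw)    = inj₂ (augment₀ ps M v≢w fv fw nw)

  -- With more colours than `listed` can hold, some colour is unlisted, and any edge carrying it
  -- gives an extension.
  extend : (∀ a → ∃₂ λ i j → i ≢ j × f i j ≡ a) → ∀ {ps e} → IsMatching ps → length FC ≤ e →
           (∀ v → length (coloursAt v) ≤ length FV + 2 * length ps + 1) →
           countBound (length FV) e (length ps) < K → Extension ps
  extend onto {ps} M FC≤ deg≤ lt with splitBy (λ s → 4 ≤? length (newAt ps s)) ps
  ... | bs , ss , p , bigs , smalls = conclude (any? (λ a → ¬? (_∈?_ _≟_ a listed)))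
    where
    open Count ps M bs ss p bigs smalls
    conclude : Dec (∃ λ a → a ∉ listed) → Extension ps
    conclude (no none) = contradiction
      (ℕₚ.≤-trans (∀∈⇒≤length λ a → decidable-stable (_∈?_ _≟_ a listed) (λ a∉ → none (a , a∉))) (length-listed FC≤ deg≤))
      (<⇒≱ lt)
    conclude (yes (a , a∉)) with onto a
    ... | i , j , i≢j , refl = [ (λ a∈ → contradiction a∈ a∉) , id ]′ (listed-or-extension i≢j)

-- Deleting a vertex and merging the colours seen at it.

index-unique : ∀ {A : Set} {x : A} {xs} → Unique xs → (p q : x ∈ xs) → index p ≡ index q
index-unique _        (here refl) (here refl) = refl
index-unique (x# ∷ _) (here refl) (there q)   = contradiction refl (lookup x# q)
index-unique (x# ∷ _) (there p)   (here refl) = contradiction refl (lookup x# p)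
index-unique (_ ∷ u)  (there p)   (there q)   = cong suc (index-unique u p q)

index-lookup : ∀ {A : Set} (xs : List A) i → index (∈-lookup {xs = xs} i) ≡ i
index-lookup (x ∷ xs) zero    = refl
index-lookup (x ∷ xs) (suc i) = cong suc (index-lookup xs i)

module _ {n K : ℕ} (g : Fin n → Fin n → Fin K) where

  Realised : Fin K → Set
  Realised x = ∃ λ i → ∃ λ j → i ≢ j × g i j ≡ x

  Realised? : Decidable Realised
  Realised? x = any? λ i → any? λ j → ¬? (i ≟ j) ×-dec (g i j ≟ x)

-- 2 ≤ n is essential: a Colouring also colours the (irrelevant) diagonal, so K₁ has no Colouring at all.
forced-copy : ∀ {n K} (G : Graph) {a} → 2 ≤ n → ForcesRainbow n G a →
              (g : Fin n → Fin n → Fin K) → (∀ i j → g i j ≡ g j i) →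
              ∀ {cs} → Unique cs → All (Realised g) cs → a ≤ length cs →
              ∃ λ φ → Rainbow G g φ
forced-copy {suc (suc n)} {K} G 2≤n@(s≤s (s≤s _)) forces g g-sym {cs} u realised a≤ =
  -- Equal colours stay equal under relabelling, so a copy multicoloured after it is multicoloured
  -- for `g`.
  φ , proj₁ rb , λ a b a' b' p q e → proj₂ rb a b a' b' p q (cong relabel e)
  where
  R : List (Fin K)
  R = filter (Realised? g) (allFin K)
  R-unique : Unique R
  R-unique = filter⁺ (Realised? g) (allFin⁺ K)
  inhabited : g zero (suc zero) ∈ R
  inhabited = ∈-filter⁺ (Realised? g) (∈-allFin _) (zero , suc zero , (λ ()) , refl)
  -- A realised colour is renamed to its position in `R`. Values of `g` outside `R` can occur only
  -- on the diagonal and receive the name of some edge colour.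
  relabel : Fin K → Fin (length R)
  relabel x with _∈?_ _≟_ x R
  ... | yes x∈ = index x∈
  ... | no  _  = index inhabited
  relabel-lookup : ∀ i → relabel (lookupList R i) ≡ i
  relabel-lookup i with _∈?_ _≟_ (lookupList R i) R
  ... | yes x∈ = trans (index-unique R-unique x∈ (∈-lookup {xs = R} i)) (index-lookup R i)
  ... | no  x∉ = contradiction (∈-lookup {xs = R} i) x∉
  onto : ∀ i → ∃ λ v → ∃ λ w → v ≢ w × relabel (g v w) ≡ i
  onto i with proj₂ (∈-filter⁻ (Realised? g) {xs = allFin K} (∈-lookup {xs = R} i))
  ... | v , w , v≢w , e = v , w , v≢w , trans (cong relabel e) (relabel-lookup i)
  merged : Colouring (suc (suc n)) (length R)
  merged = record { col = λ i j → relabel (g i j) ; col-sym = λ i j → cong relabel (g-sym i j) ; col-onto = onto }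
  copy : MulticolouredCopy G merged
  copy = forces (length R) (ℕₚ.≤-trans a≤ (Unique-⊆⇒length≤ u
           (λ x∈ → ∈-filter⁺ (Realised? g) (∈-allFin _) (lookup realised x∈)))) merged
  φ = proj₁ copy
  rb = proj₂ copy

module _ {n k : ℕ} (c : Colouring (suc n) k) where

  private
    f = col c
    f-sym = col-sym c
  open RainbowMatching f f-sym
  open Augment f f-sym [] [] using (coloursAt; ∈-coloursAt)

  length-coloursAt : ∀ v → length (coloursAt v) ≤ n
  length-coloursAt v = subst (length (coloursAt v) ≤_)
    (trans (length-map (f v ∘ punchIn v) (allFin n)) (length-tabulate {n = n} id))
    (Unique-⊆⇒length≤ (filter⁺ _ (allFin⁺ k)) ⊆-star)
    where
    ⊆-star : ∀ {x} → x ∈ coloursAt v → x ∈ map (f v ∘ punchIn v) (allFin n)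
    ⊆-star x∈ with proj₂ (∈-filter⁻ (λ a → any? (λ w → ¬? (v ≟ w) ×-dec (f v w ≟ a))) {xs = allFin k} x∈)
    ... | w , v≢w , refl = subst (λ z → f v z ∈ map (f v ∘ punchIn v) (allFin n)) (punchIn-punchOut v≢w)
                             (∈-map⁺ (f v ∘ punchIn v) (∈-allFin (punchOut v≢w)))

  module _ (v : Fin (suc n)) where

    mergeSeen : Fin k → Fin (suc k)
    mergeSeen x with _∈?_ _≟_ x (coloursAt v)
    ... | yes _ = zero
    ... | no  _ = suc x

    mergeSeen-seen : ∀ {x} → x ∈ coloursAt v → mergeSeen x ≡ zero
    mergeSeen-seen {x} x∈ with _∈?_ _≟_ x (coloursAt v)
    ... | yes _  = refl
    ... | no  x∉ = contradiction x∈ x∉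

    mergeSeen-unseen : ∀ {x} → x ∉ coloursAt v → mergeSeen x ≡ suc x
    mergeSeen-unseen {x} x∉ with _∈?_ _≟_ x (coloursAt v)
    ... | yes x∈ = contradiction x∈ x∉
    ... | no  _  = refl

    -- An edge whose colour is unseen at `v` misses `v`, so every unseen colour survives the
    -- deletion, and there are at least a of them. Two edges of the copy with seen colours share the
    -- merged colour and are therefore the same edge.
    copy-avoiding-star : ∀ (G : Graph) {a} → 2 ≤ n → ForcesRainbow n G a → a + n ≤ k →
      ∃ λ φ → Rainbow G f φ × (∀ a → v ≢ φ a) ×
        (∀ a b a' b' → adj G a b ≡ true → adj G a' b' ≡ true →
           f (φ a) (φ b) ∈ coloursAt v → f (φ a') (φ b') ∈ coloursAt v →
           f (φ a) (φ b) ≡ f (φ a') (φ b'))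
    copy-avoiding-star G {a} 2≤n forces a+n≤k =
      punchIn v ∘ φ ,
      (inj ∘ punchIn-injective v _ _ , λ a b a' b' p q e → rb a b a' b' p q (cong mergeSeen e)) ,
      (λ a e → punchInᵢ≢i v (φ a) (≡-sym e)) ,
      λ a b a' b' p q s s' → sameEdge (rb a b a' b' p q (trans (mergeSeen-seen s) (≡-sym (mergeSeen-seen s'))))
      where
      unseen : List (Fin k)
      unseen = filter (λ x → ¬? (_∈?_ _≟_ x (coloursAt v))) (allFin k)
      f⁻ : Fin n → Fin n → Fin k
      f⁻ i j = f (punchIn v i) (punchIn v j)
      all-listed : ∀ x → x ∈ coloursAt v ++ unseen
      all-listed x with _∈?_ _≟_ x (coloursAt v)
      ... | yes x∈ = ∈-++⁺ˡ x∈
      ... | no  x∉ = ∈-++⁺ʳ (coloursAt v) (∈-filter⁺ _ (∈-allFin x) x∉)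
      enough : a ≤ length unseen
      enough = +-cancelˡ-≤ n a (length unseen) (ℕₚ.≤-trans (ℕₚ.≤-reflexive (ℕₚ.+-comm n a)) (ℕₚ.≤-trans a+n≤k
        (ℕₚ.≤-trans (∀∈⇒≤length all-listed) (ℕₚ.≤-trans (ℕₚ.≤-reflexive (length-++ (coloursAt v)))
          (+-monoˡ-≤ (length unseen) (length-coloursAt v))))))
      realise : ∀ {x i j} → x ∉ coloursAt v → i ≢ j → f i j ≡ x → Realised (λ i j → mergeSeen (f⁻ i j)) (suc x)
      realise {x} {i} {j} x∉ i≢j refl = punchOut v≢i , punchOut v≢j ,
        (λ e → i≢j (trans (≡-sym (punchIn-punchOut v≢i)) (trans (cong (punchIn v) e) (punchIn-punchOut v≢j)))) ,
        trans (cong mergeSeen (cong₂ f (punchIn-punchOut v≢i) (punchIn-punchOut v≢j))) (mergeSeen-unseen x∉)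
        where
        v≢i : v ≢ i
        v≢i refl = x∉ (∈-coloursAt i≢j)
        v≢j : v ≢ j
        v≢j refl = x∉ (subst (_∈ coloursAt v) (f-sym j i) (∈-coloursAt (≢-sym i≢j)))
      realised : All (Realised (λ i j → mergeSeen (f⁻ i j))) (map suc unseen)
      realised = tabulate λ y∈ → case-map (∈-map⁻ suc y∈)
        where
        case-map : ∀ {y} → (∃ λ x → x ∈ unseen × y ≡ suc x) → Realised (λ i j → mergeSeen (f⁻ i j)) y
        case-map (x , x∈ , refl) with col-onto c x
        ... | i , j , i≢j , e = realise (proj₂ (∈-filter⁻ (λ x → ¬? (_∈?_ _≟_ x (coloursAt v))) {xs = allFin k} x∈)) i≢j e
      copy : ∃ λ φ → Rainbow G (λ i j → mergeSeen (f⁻ i j)) φ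
      copy = forced-copy G 2≤n forces (λ i j → mergeSeen (f⁻ i j)) (λ i j → cong mergeSeen (f-sym _ _))
        (Unique-map⁺ Fin-suc-injective (filter⁺ _ (allFin⁺ k))) realised
        (ℕₚ.≤-trans enough (ℕₚ.≤-reflexive (≡-sym (length-map suc unseen))))
      φ = proj₁ copy
      inj = λ {x} {y} → proj₁ (proj₂ copy) {x} {y}
      rb = proj₂ (proj₂ copy)
      sameEdge : ∀ {a b a' b'} → ((a ≡ a') × (b ≡ b')) ⊎ ((a ≡ b') × (b ≡ a')) → f⁻ (φ a) (φ b) ≡ f⁻ (φ a') (φ b')
      sameEdge (inj₁ (refl , refl)) = refl
      sameEdge (inj₂ (refl , refl)) = f-sym _ _

-- The step from t to t + 1.

at-most-one : ∀ {A : Set} {P : A → Set} → Decidable P → ∀ xs →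
              (∀ {x y} → x ∈ xs → y ∈ xs → P x → P y → x ≡ y) →
              ∃ λ ys → length ys ≤ 1 × (∀ {x} → x ∈ xs → P x → x ∈ ys)
at-most-one P? xs unique with Any.any? P? xs
... | no none = [] , z≤n , λ x∈ px → contradiction (Any.map (λ { refl → px }) x∈) none
... | yes some with find some
...   | y , y∈ , py = y ∷ [] , s≤s z≤n , λ x∈ px → here (unique x∈ y∈ px py)

-- The square of the order of `L` bounds the number of its colours; the `suc` supplies the strict
-- inequality in `extend`.
stepBound : Graph → ℕ → ℕ
stepBound L m = suc (countBound (size L) (size L * size L) m)

forces-step : ∀ (L : Graph) m {n a} → 2 ≤ n → ForcesRainbow n (L ∪G matching m) a →
              ForcesRainbow (suc n) (L ∪G matching (suc m)) ((a + n) ⊔ stepBound L m)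
forces-step L m {n} {a} 2≤n forces k k≥ c = main (any? λ v → D <? length (coloursAtᶜ v))
  where
  f = col c
  f-sym = col-sym c
  ℓ = size L
  -- An edge at a vertex outside the copy must miss the ℓ + 2m vertices of the copy and the one
  -- colour that the copy may share with that vertex.
  D = ℓ + 2 * m + 1
  open RainbowMatching f f-sym
  open Copies L
  open Augment f f-sym [] [] using () renaming (coloursAt to coloursAtᶜ)
  module U = Union L (matching m)

  |vertices| : ∀ φ → length (vertices φ) ≡ ℓ
  |vertices| φ = trans (length-map φ (allFin ℓ)) (length-tabulate {n = ℓ} id)

  |colours| : ∀ φ → length (colours φ) ≤ ℓ * ℓ
  |colours| φ = ℕₚ.≤-trans (ℕₚ.≤-reflexive (length-map _ edges)) (ℕₚ.≤-trans (length-filter _ (cartesianProduct (allFin ℓ) (allFin ℓ)))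
    (ℕₚ.≤-reflexive (trans (length-cartesianProductWith _,_ (allFin ℓ) (allFin ℓ)) (cong₂ _*_ (length-tabulate {n = ℓ} id) (length-tabulate {n = ℓ} id)))))

  conclude : ∀ {φ} → Rainbow L f φ →
             ∀ (ps : List (Edge (suc n))) → length ps ≡ m → (∃ λ qs → MatchingAround φ qs × length qs ≡ suc (length ps)) →
             MulticolouredCopy (L ∪G matching (suc m)) c
  conclude rL ps len (qs , Mq , lenq) = compose (suc m) rL Mq (trans lenq (cong suc len))

  lowCase : (∀ v → length (coloursAtᶜ v) ≤ D) → ∀ φ → Rainbow (L ∪G matching m) f φ →
            MulticolouredCopy (L ∪G matching (suc m)) c
  lowCase low φ rb = conclude (proj₁ (decompose m rb)) (pairs m (φ ∘ U.inr)) (length-pairs m (φ ∘ U.inr))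
    (Augment.extend f f-sym (vertices (φ ∘ U.inl)) (colours (φ ∘ U.inl)) (col-onto c)
      (proj₂ (decompose m rb)) (|colours| (φ ∘ U.inl))
      (λ v → subst (length (coloursAtᶜ v) ≤_)
               (≡-sym (cong₂ (λ x y → x + 2 * y + 1) (|vertices| (φ ∘ U.inl)) (length-pairs m (φ ∘ U.inr))))
               (low v))
      (subst (_< k) (≡-sym (cong₂ (λ x y → countBound x (ℓ * ℓ) y) (|vertices| (φ ∘ U.inl)) (length-pairs m (φ ∘ U.inr))))
        (m⊔n≤o⇒n≤o (a + n) _ k≥)))

  highCase : ∀ v → D < length (coloursAtᶜ v) → ∀ φ → Rainbow (L ∪G matching m) f φ → (∀ a → v ≢ φ a) →
             (∀ a b a' b' → unionAdj L (matching m) a b ≡ true → unionAdj L (matching m) a' b' ≡ true →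
                f (φ a) (φ b) ∈ coloursAtᶜ v → f (φ a') (φ b') ∈ coloursAtᶜ v →
                f (φ a) (φ b) ≡ f (φ a') (φ b')) →
             MulticolouredCopy (L ∪G matching (suc m)) c
  highCase v high φ rb avoids oneSeen =
    conclude (proj₁ (decompose m rb)) (pairs m (φ ∘ U.inr)) (length-pairs m (φ ∘ U.inr)) extension
    where
    FV = vertices (φ ∘ U.inl)
    FC = colours (φ ∘ U.inl)
    ps = pairs m (φ ∘ U.inr)
    open Augment f f-sym FV FC

    OnEdge : Fin k → Set
    OnEdge x = ∃₂ λ a b → unionAdj L (matching m) a b ≡ true × x ≡ f (φ a) (φ b)

    used : List (Fin k)
    used = FC ++ map colour ps

    used-onEdge : ∀ {x} → x ∈ used → OnEdge x
    used-onEdge x∈ with ∈-++⁻ FC x∈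
    ... | inj₁ i with colours⁻ (φ ∘ U.inl) i
    ...   | a , b , p , e = U.inl a , U.inl b , trans (U.adj-ll a b) p , e
    used-onEdge x∈ | inj₂ i with ∈-map⁻ colour i
    ... | e , e∈ , refl =
      lookup (All-pairs⁺ {P = λ e → OnEdge (colour e)} m
                (λ a b p → U.inr a , U.inr b , trans (U.adj-rr a b) p , refl)) e∈

    seen-used : ∃ λ ys → length ys ≤ 1 × (∀ {x} → x ∈ used → x ∈ coloursAt v → x ∈ ys)
    seen-used = at-most-one (λ x → _∈?_ _≟_ x (coloursAt v)) used unique
      where
      unique : ∀ {x y} → x ∈ used → y ∈ used → x ∈ coloursAt v → y ∈ coloursAt v → x ≡ y
      unique x∈ y∈ sx sy with used-onEdge x∈ | used-onEdge y∈
      ... | a , b , p , refl | a' , b' , q , refl = oneSeen a b a' b' p q sx sy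
    ys = proj₁ seen-used

    hit : List (Fin (suc n))
    hit = FV ++ map proj₁ ps ++ map proj₂ ps

    |hit| : length hit ≡ ℓ + (m + m)
    |hit| = trans (length-++ FV) (cong₂ _+_ (|vertices| _) (trans (length-++ (map proj₁ ps))
      (cong₂ _+_ (trans (length-map proj₁ ps) (length-pairs m _)) (trans (length-map proj₂ ps) (length-pairs m _)))))

    -- Only used colours seen at `v` can obstruct an edge at `v`, so `ys`, of length at most one,
    -- replaces all of `used`.
    short : length (map (f v) hit ++ ys) < length (coloursAt v)
    short = ℕₚ.≤-trans (s≤s (ℕₚ.≤-trans (ℕₚ.≤-reflexive (length-++ (map (f v) hit)))
      (ℕₚ.+-mono-≤ (ℕₚ.≤-reflexive (trans (length-map (f v) hit) (trans |hit| (cong (λ z → ℓ + (m + z)) (ℕₚ.+-comm 0 m)))))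
                (proj₁ (proj₂ seen-used))))) high

    v∉FV : v ∉ FV
    v∉FV i with ∈-map⁻ (φ ∘ U.inl) i
    ... | a , _ , e = avoids (U.inl a) e

    extension : ∃ λ qs → Around.IsMatching FV FC qs × length qs ≡ suc (length ps)
    extension with ∃-avoiding (map (f v) hit ++ ys) (filter⁺ _ (allFin⁺ k)) short
    ... | x , x∈ , x∉ with proj₂ (∈-filter⁻ (λ a → any? (λ w → ¬? (v ≟ w) ×-dec (f v w ≟ a))) {xs = allFin k} x∈)
    ...   | w , v≢w , refl = augment₀ ps (proj₂ (decompose m rb)) v≢w
      (v∉FV , All-pairs-vertices⁺ m (λ a → avoids (U.inr a)))
      (w∉hit ∘ ∈-++⁺ˡ , tabulate λ e∈ → (λ { refl → w∉hit (∈-++⁺ʳ FV (∈-++⁺ˡ (∈-map⁺ proj₁ e∈))) }) ,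
                                        (λ { refl → w∉hit (∈-++⁺ʳ FV (∈-++⁺ʳ (map proj₁ ps) (∈-map⁺ proj₂ e∈))) }))
      (unused ∘ ∈-++⁺ˡ , tabulate λ e∈ eq → unused (∈-++⁺ʳ FC (subst (_∈ map colour ps) (≡-sym eq) (∈-map⁺ colour e∈))))
      where
      w∉hit : w ∉ hit
      w∉hit i = x∉ (∈-++⁺ˡ (∈-map⁺ (f v) i))
      unused : f v w ∉ used
      unused i = x∉ (∈-++⁺ʳ (map (f v) hit) (proj₂ (proj₂ seen-used) i x∈))

  main : Dec (∃ λ v → D < length (coloursAtᶜ v)) → MulticolouredCopy (L ∪G matching (suc m)) c
  main (no low) =
    -- The vertex `zero` is an arbitrary choice: when every vertex is low, only the copy itself is
    -- wanted.
    let φ , rb , _ = copy-avoiding-star c zero (L ∪G matching m) 2≤n forces (m⊔n≤o⇒m≤o _ _ k≥) in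
    lowCase (λ v → ≮⇒≥ (λ h → low (v , h))) φ rb
  main (yes (v , high)) =
    let φ , rb , avoids , oneSeen = copy-avoiding-star c v (L ∪G matching m) 2≤n forces (m⊔n≤o⇒m≤o _ _ k≥) in
    highCase v high φ rb avoids oneSeen

-- Existence of anti-Ramsey numbers: ARAtMost only speaks about a given value of AR, so to use the
-- hypothesis one has to find that value, constructively by exhausting all colourings.

Searchable : Set → Set₁
Searchable A = ∀ {P : A → Set} → Decidable P → Dec (∃ P)

Fin-searchable : ∀ n → Searchable (Fin n)
Fin-searchable n P? = any? P?

Vec-searchable : ∀ {A} → Searchable A → ∀ n → Searchable (Vec A n)
Vec-searchable s zero    P? = map′ ([] ,_) (λ { ([] , p) → p }) (P? [])
Vec-searchable s (suc n) P? =
  map′ (λ (x , xs , p) → x ∷ xs , p) (λ { (x ∷ xs , p) → x , xs , p })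
    (s λ x → Vec-searchable s n λ xs → P? (x ∷ xs))

module _ {n K : ℕ} (G : Graph) where

  Rainbow-cong : ∀ {f g : Fin n → Fin n → Fin K} {φ} → (∀ i j → f i j ≡ g i j) → Rainbow G f φ → Rainbow G g φ
  Rainbow-cong eq (inj , rb) = inj , λ a b a' b' p q e → rb a b a' b' p q (trans (eq _ _) (trans e (≡-sym (eq _ _))))

  Rainbow? : ∀ (f : Fin n → Fin n → Fin K) φ → Dec (Rainbow G f φ)
  Rainbow? f φ =
    map′ (λ h {x} {y} → h x y) (λ h x y → h {x} {y}) (all? λ x → all? λ y → (φ x ≟ φ y) →-dec (x ≟ y))
    ×-dec
    (all? λ a → all? λ b → all? λ a' → all? λ b' →
       (adj G a b ≟ᵇ true) →-dec ((adj G a' b' ≟ᵇ true) →-dec ((f (φ a) (φ b) ≟ f (φ a') (φ b')) →-dec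
         (((a ≟ a') ×-dec (b ≟ b')) ⊎-dec ((a ≟ b') ×-dec (b ≟ a'))))))

  hasRainbow? : ∀ (f : Fin n → Fin n → Fin K) → Dec (∃ λ φ → Rainbow G f φ)
  hasRainbow? f = map′ (λ (v , r) → Vec.lookup v , r)
    (λ (φ , r) → Vec.tabulate φ , Rainbow-resp-≗ G {f} (λ a → ≡-sym (lookup∘tabulate φ a)) r)
    (Vec-searchable (Fin-searchable n) (size G) λ v → Rainbow? f (Vec.lookup v))

Avoiding : ℕ → Graph → ℕ → Set
Avoiding n G k = Σ (Colouring n k) λ c → ¬ MulticolouredCopy G c

avoiding? : ∀ n G k → Dec (Avoiding n G k)
avoiding? n G k = map′ to from (Vec-searchable (Vec-searchable (Fin-searchable k) n) n λ t → valid? (entry t))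
  where
  entry : Vec (Vec (Fin k) n) n → Fin n → Fin n → Fin k
  entry t i j = Vec.lookup (Vec.lookup t i) j
  Valid : (Fin n → Fin n → Fin k) → Set
  Valid f = (∀ i j → f i j ≡ f j i) × (∀ a → Σ (Fin n) λ i → Σ (Fin n) λ j → (i ≢ j) × (f i j ≡ a)) ×
            ¬ (∃ λ φ → Rainbow G f φ)
  valid? : ∀ f → Dec (Valid f)
  valid? f = (all? λ i → all? λ j → f i j ≟ f j i) ×-dec
             ((all? λ a → any? λ i → any? λ j → ¬? (i ≟ j) ×-dec (f i j ≟ a)) ×-dec ¬? (hasRainbow? G f))
  to : (∃ λ t → Valid (entry t)) → Avoiding n G k
  to (t , s , o , none) = record { col = entry t ; col-sym = s ; col-onto = o } , none
  from : Avoiding n G k → ∃ λ t → Valid (entry t)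
  from (c , none) = t ,
    (λ i j → trans (eq i j) (trans (col-sym c i j) (≡-sym (eq j i)))) ,
    (λ a → let i , j , i≢j , e = col-onto c a in i , j , i≢j , trans (eq i j) e) ,
    (λ (φ , r) → none (φ , Rainbow-cong G eq r))
    where
    t : Vec (Vec (Fin k) n) n
    t = Vec.tabulate λ i → Vec.tabulate (col c i)
    eq : ∀ i j → entry t i j ≡ col c i j
    eq i j = trans (cong (λ v → Vec.lookup v j) (lookup∘tabulate (λ i → Vec.tabulate (col c i)) i)) (lookup∘tabulate (col c i) j)

-- Each colour is coded by an edge carrying it, and an edge determines its colour.
colours≤n*n : ∀ {n k} → Colouring n k → k ≤ n * n
colours≤n*n {n} {k} c = injective⇒≤ {f = code} inj
  where
  code : Fin k → Fin (n * n)
  code a = combine (proj₁ (col-onto c a)) (proj₁ (proj₂ (col-onto c a)))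
  inj : Injective _≡_ _≡_ code
  inj {a} {b} e with col-onto c a | col-onto c b
  ... | i , j , _ , refl | i' , j' , _ , refl with combine-injective i j i' j' e
  ...   | refl , refl = refl

AR-exists : ∀ n G → ∃ (IsAR n G)
-- No colouring has more than n² colours, so the property holds vacuously there and the downward
-- search can start.
AR-exists n G = descend (suc (n * n)) λ k lt c → contradiction (colours≤n*n c) (<⇒≱ lt)
  where
  descend : ∀ r → ForcesRainbow n G r → ∃ (IsAR n G)
  descend zero    forces = zero , forces , λ _ _ → z≤n
  descend (suc r) forces with avoiding? n G r
  ... | yes (c , none) = suc r , forces , λ r' forces' → ≰⇒> λ r'≤r → none (forces' r r'≤r c)
  ... | no  ¬avoid     = descend r forces-r
    where
    forces-r : ForcesRainbow n G r
    forces-r k r≤k c with m≤n⇒m<n∨m≡n r≤k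
    ... | inj₁ r<k  = forces k r<k c
    ... | inj₂ refl with hasRainbow? G (col c)
    ...   | yes copy = copy
    ...   | no  none = contradiction (c , none) ¬avoid

-- Ordered fields

module OrderedFieldProperties {c ℓ₁ ℓ₂} (F : OrderedField c ℓ₁ ℓ₂) where

  open OrderedField F
  open IsTotalOrder isTotalOrder using (total; antisym) renaming (reflexive to ≤-reflexive; trans to ≤-trans)

  commutativeRing : CommutativeRing c ℓ₁
  commutativeRing = record { isCommutativeRing = isCommutativeRing }

  open CommutativeRing commutativeRing
    using (setoid; +-cong; +-congˡ; +-congʳ; *-cong; *-congˡ; *-congʳ; -‿cong; +-identityˡ; +-identityʳ;
           +-assoc; +-comm; *-identityˡ; zeroˡ; zeroʳ; distribˡ; distribʳ; -‿inverseʳ; -‿inverseˡ; ring)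
    renaming (refl to ≈-refl; sym to ≈-sym; trans to ≈-trans)
  open import Algebra.Properties.Ring ring using (-‿distribˡ-*; -‿distribʳ-*; -‿+-comm; -‿involutive; -0#≈0#)
  open import Relation.Binary.Reasoning.Setoid setoid

  fromℕ-+ : ∀ m n → fromℕ (m + n) ≈ fromℕ m +F fromℕ n
  fromℕ-+ zero    n = ≈-sym (+-identityˡ _)
  fromℕ-+ (suc m) n = ≈-trans (+-congˡ (fromℕ-+ m n)) (≈-sym (+-assoc _ _ _))

  fromℕ-* : ∀ m n → fromℕ (m * n) ≈ fromℕ m *F fromℕ n
  fromℕ-* zero    n = ≈-sym (zeroˡ _)
  fromℕ-* (suc m) n = begin
    fromℕ (n + m * n)                           ≈⟨ fromℕ-+ n (m * n) ⟩
    fromℕ n +F fromℕ (m * n)                    ≈⟨ +-cong (≈-sym (*-identityˡ _)) (fromℕ-* m n) ⟩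
    (1F *F fromℕ n) +F (fromℕ m *F fromℕ n)     ≈⟨ distribʳ _ _ _ ⟨
    (1F +F fromℕ m) *F fromℕ n                  ∎

  -- Coefficients for the ring solver: equality of integers is decidable, whereas equality in the
  -- field is not assumed to be.
  fromℤ : ℤ → Carrier
  fromℤ (pos n)    = fromℕ n
  fromℤ -[1+ n ] = -F fromℕ (suc n)

  fromℤ-neg : ∀ i → fromℤ (ℤ.- i) ≈ -F fromℤ i
  fromℤ-neg (pos zero)  = ≈-sym -0#≈0#
  fromℤ-neg (pos (suc n)) = ≈-refl
  fromℤ-neg -[1+ n ]  = ≈-sym (-‿involutive _)

  fromℤ-⊖ : ∀ m n → fromℤ (m ⊖ n) ≈ fromℕ m +F (-F fromℕ n)
  fromℤ-⊖ m       zero    = ≈-sym (≈-trans (+-congˡ -0#≈0#) (+-identityʳ _))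
  fromℤ-⊖ zero    (suc n) = ≈-sym (+-identityˡ _)
  fromℤ-⊖ (suc m) (suc n) = begin
    fromℤ (suc m ⊖ suc n)                              ≡⟨ cong fromℤ (ℤₚ.[1+m]⊖[1+n]≡m⊖n m n) ⟩
    fromℤ (m ⊖ n)                                      ≈⟨ fromℤ-⊖ m n ⟩
    fromℕ m +F (-F fromℕ n)                            ≈⟨ +-congʳ (+-identityˡ _) ⟨
    (0F +F fromℕ m) +F (-F fromℕ n)                    ≈⟨ +-congʳ (+-congʳ (-‿inverseʳ 1F)) ⟨
    ((1F +F (-F 1F)) +F fromℕ m) +F (-F fromℕ n)       ≈⟨ +-congʳ (≈-trans (+-assoc _ _ _) (≈-trans (+-congˡ (+-comm _ _)) (≈-sym (+-assoc _ _ _)))) ⟩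
    (fromℕ (suc m) +F (-F 1F)) +F (-F fromℕ n)         ≈⟨ +-assoc _ _ _ ⟩
    fromℕ (suc m) +F ((-F 1F) +F (-F fromℕ n))         ≈⟨ +-congˡ (-‿+-comm _ _) ⟩
    fromℕ (suc m) +F (-F fromℕ (suc n))                ∎

  fromℤ-+ : ∀ i j → fromℤ (i ℤ.+ j) ≈ fromℤ i +F fromℤ j
  fromℤ-+ (pos m)    (pos n)    = fromℕ-+ m n
  fromℤ-+ (pos m)    -[1+ n ] = fromℤ-⊖ m (suc n)
  fromℤ-+ -[1+ m ] (pos n)    = ≈-trans (fromℤ-⊖ n (suc m)) (+-comm _ _)
  fromℤ-+ -[1+ m ] -[1+ n ] = begin
    -F fromℕ (suc (suc (m + n)))             ≡⟨ cong (λ k → -F fromℕ (suc k)) (≡-sym (+-suc m n)) ⟩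
    -F fromℕ (suc m + suc n)                 ≈⟨ -‿cong (fromℕ-+ (suc m) (suc n)) ⟩
    -F (fromℕ (suc m) +F fromℕ (suc n))      ≈⟨ -‿+-comm _ _ ⟨
    (-F fromℕ (suc m)) +F (-F fromℕ (suc n)) ∎

  fromℤ-+* : ∀ m j → fromℤ (pos m ℤ.* j) ≈ fromℕ m *F fromℤ j
  fromℤ-+* m (pos n) = begin
    fromℤ (pos m ℤ.* pos n)    ≡⟨ cong fromℤ (ℤₚ.pos-* m n) ⟨
    fromℕ (m * n)          ≈⟨ fromℕ-* m n ⟩
    fromℕ m *F fromℕ n     ∎
  fromℤ-+* m -[1+ n ] = begin
    fromℤ (pos m ℤ.* -[1+ n ])          ≡⟨ cong fromℤ (ℤₚ.neg-distribʳ-* (pos m) (pos (suc n))) ⟨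
    fromℤ (ℤ.- (pos m ℤ.* pos (suc n)))     ≈⟨ fromℤ-neg (pos m ℤ.* pos (suc n)) ⟩
    -F fromℤ (pos m ℤ.* pos (suc n))        ≈⟨ -‿cong (fromℤ-+* m (pos (suc n))) ⟩
    -F (fromℕ m *F fromℕ (suc n))     ≈⟨ -‿distribʳ-* _ _ ⟩
    fromℕ m *F (-F fromℕ (suc n))     ∎

  fromℤ-* : ∀ i j → fromℤ (i ℤ.* j) ≈ fromℤ i *F fromℤ j
  fromℤ-* (pos m)    j = fromℤ-+* m j
  fromℤ-* -[1+ m ] j = begin
    fromℤ (-[1+ m ] ℤ.* j)            ≡⟨ cong fromℤ (ℤₚ.neg-distribˡ-* (pos (suc m)) j) ⟨
    fromℤ (ℤ.- (pos (suc m) ℤ.* j))       ≈⟨ fromℤ-neg (pos (suc m) ℤ.* j) ⟩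
    -F fromℤ (pos (suc m) ℤ.* j)          ≈⟨ -‿cong (fromℤ-+* (suc m) j) ⟩
    -F (fromℕ (suc m) *F fromℤ j)     ≈⟨ -‿distribˡ-* _ _ ⟩
    (-F fromℕ (suc m)) *F fromℤ j     ∎

  private
    almostCommutativeRing = fromCommutativeRing commutativeRing

    fromℤ-morphism : ℤ.+-*-rawRing -Raw-AlmostCommutative⟶ almostCommutativeRing
    fromℤ-morphism = record
      { ⟦_⟧ = fromℤ ; +-homo = fromℤ-+ ; *-homo = fromℤ-* ; -‿homo = fromℤ-neg
      ; 0-homo = ≈-refl ; 1-homo = +-identityʳ 1F }

    fromℤ-weaklyDec : ∀ i j → Maybe (fromℤ i ≈ fromℤ j)
    fromℤ-weaklyDec i j with i ℤₚ.≟ j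
    ... | yes refl = just ≈-refl
    ... | no  _      = nothing

  open Algebra.Solver.Ring ℤ.+-*-rawRing almostCommutativeRing fromℤ-morphism fromℤ-weaklyDec
    using (solve; _:+_; _:*_; _:-_; :-_; con; _:=_)

  ≤-refl : ∀ {x} → x ≤F x
  ≤-refl = ≤-reflexive ≈-refl

  ≤-respˡ : ∀ {x y z} → x ≈ y → x ≤F z → y ≤F z
  ≤-respˡ e h = ≤-trans (≤-reflexive (≈-sym e)) h

  ≤-respʳ : ∀ {x y z} → y ≈ z → x ≤F y → x ≤F z
  ≤-respʳ e h = ≤-trans h (≤-reflexive e)

  +-mono : ∀ {x y u v} → x ≤F y → u ≤F v → (x +F u) ≤F (y +F v)
  +-mono {x} {y} {u} {v} p q = ≤-trans (+-mono-≤ u p) (≤-respˡ (+-comm _ _) (≤-respʳ (+-comm _ _) (+-mono-≤ y q)))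

  +-nonneg : ∀ {x y} → 0F ≤F x → 0F ≤F y → 0F ≤F (x +F y)
  +-nonneg p q = ≤-respˡ (+-identityˡ 0F) (+-mono p q)

  ≤⇒0≤- : ∀ {x y} → x ≤F y → 0F ≤F (y -F x)
  ≤⇒0≤- {x} p = ≤-respˡ (-‿inverseʳ x) (+-mono-≤ (-F x) p)

  0≤-⇒≤ : ∀ {x y} → 0F ≤F (y -F x) → x ≤F y
  0≤-⇒≤ {x} {y} p = ≤-respˡ (+-identityˡ x) (≤-respʳ (≈-trans (+-assoc _ _ _) (≈-trans (+-congˡ (-‿inverseˡ x)) (+-identityʳ y))) (+-mono-≤ x p))

  ≤0⇒0≤neg : ∀ {x} → x ≤F 0F → 0F ≤F (-F x)
  ≤0⇒0≤neg p = ≤-respʳ (+-identityˡ _) (≤⇒0≤- p)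

  0≤1 : 0F ≤F 1F
  0≤1 with total 0F 1F
  ... | inj₁ p = p
  ... | inj₂ p = ≤-respʳ (≈-trans (solve 0 ((:- con (pos 1)) :* (:- con (pos 1)) := con (pos 1)) ≈-refl) (+-identityʳ 1F)) (*-nonneg n n)
    where
    n : 0F ≤F (-F fromℕ 1)
    n = ≤0⇒0≤neg (≤-respˡ (≈-sym (+-identityʳ 1F)) p)

  1≰0 : ¬ (1F ≤F 0F)
  1≰0 p = 0≉1 (antisym 0≤1 p)

  fromℕ-nonneg : ∀ n → 0F ≤F fromℕ n
  fromℕ-nonneg zero    = ≤-refl
  fromℕ-nonneg (suc n) = +-nonneg 0≤1 (fromℕ-nonneg n)

  fromℕ-mono : ∀ {m n} → m ≤ n → fromℕ m ≤F fromℕ n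
  fromℕ-mono {n = n} z≤n = fromℕ-nonneg n
  fromℕ-mono (s≤s p) = +-mono ≤-refl (fromℕ-mono p)

  fromℕ-cancel-≤ : ∀ {m n} → fromℕ m ≤F fromℕ n → m ≤ n
  fromℕ-cancel-≤ {m} {n} p with m ≤? n
  ... | yes q = q
  ... | no ¬q = contradiction
    (0≤-⇒≤ (≤-respʳ (≈-trans (solve 1 (λ x → x :- (con (pos 1) :+ x) := con (pos 0) :- con (pos 1)) ≈-refl (fromℕ n)) (+-congˡ (-‿cong (+-identityʳ 1F))))
      (≤⇒0≤- (≤-respˡ (+-congʳ (≈-sym (+-identityʳ 1F))) (≤-trans (fromℕ-mono (≰⇒> ¬q)) p)))))
    1≰0

  2≉0 : ¬ ((1F +F 1F) ≈ 0F)
  2≉0 e = 1≰0 (≤-respʳ e (≤-respˡ (+-identityʳ 1F) (+-mono ≤-refl 0≤1)))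

  ½+½≈1 : (½ +F ½) ≈ 1F
  ½+½≈1 = ≈-trans (≈-sym (≈-trans (distribʳ _ _ _) (+-cong (*-identityˡ ½) (*-identityˡ ½)))) (⁻¹-inverse _ 2≉0)

  0≤½ : 0F ≤F ½
  0≤½ with total 0F ½
  ... | inj₁ p = p
  ... | inj₂ p = contradiction (≤-respˡ ½+½≈1 (≤-respʳ (+-identityˡ 0F) (+-mono p p))) 1≰0

  *½-double : ∀ x → (½ *F (x +F x)) ≈ x
  *½-double x = ≈-trans (distribˡ _ _ _) (≈-trans (≈-sym (distribʳ _ _ _)) (≈-trans (*-congʳ ½+½≈1) (*-identityˡ x)))

  double-cancel-≤ : ∀ {x y} → (x +F x) ≤F (y +F y) → x ≤F y
  double-cancel-≤ {x} {y} p = 0≤-⇒≤ (≤-respʳ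
    (≈-trans (distribˡ ½ (y +F y) (-F (x +F x)))
       (+-cong (*½-double y) (≈-trans (≈-sym (-‿distribʳ-* _ _)) (-‿cong (*½-double x)))))
    (*-nonneg 0≤½ (≤⇒0≤- p)))

  1-2½≈0 : (fromℕ 1 -F (½ +F ½)) ≈ 0F
  1-2½≈0 = ≈-trans (+-cong (+-identityʳ 1F) (-‿cong ½+½≈1)) (-‿inverseʳ 1F)

  vanish : ∀ x → (x *F (fromℕ 1 -F (½ +F ½))) ≈ 0F
  vanish x = ≈-trans (*-congˡ 1-2½≈0) (zeroʳ x)

  -- The ring solver does not know that ½ + ½ = 1; identities that need it are proved with an explicit
  -- multiple of 1 - (½ + ½) added to one side.
  drop-vanish : ∀ {y} z x → y ≈ (z +F (x *F (fromℕ 1 -F (½ +F ½)))) → y ≈ z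
  drop-vanish z x e = ≈-trans e (≈-trans (+-congˡ (vanish x)) (+-identityʳ z))

  -- The solver reads the literal 1 as fromℕ 1 = 1F +F 0F.
  one : 1F ≈ fromℕ 1
  one = ≈-sym (+-identityʳ 1F)

  -- Identities and inequalities for the bound.

  bound′ : (τ ν r s : Carrier) → Carrier
  bound′ τ ν r s = (((τ +F r) *F (ν -F (((τ +F r) +F fromℕ 1) *F ½))) +F s) +F fromℕ 1

  bound≈bound′ : ∀ t n r s {τ ν} → fromℕ t ≈ τ → fromℕ n ≈ ν → bound F t n r s ≈ bound′ τ ν r s
  bound≈bound′ t n r s p q =
    +-cong (+-congʳ (*-cong (+-congʳ p) (+-cong q (-‿cong (*-congʳ (+-cong (+-congʳ p) one)))))) one

  -- Apart from s + 1, the bound is the number of edges of K_n that meet a fixed set of t + r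
  -- vertices. A vertex added both to K_n and to the set contributes its n edges.
  bound-suc : ∀ m n r s → bound F (suc m) (suc n) r s ≈ (bound F m n r s +F fromℕ n)
  bound-suc m n r s = drop-vanish _ ((fromℕ m +F r) +F fromℕ 1)
    (≈-trans (bound≈bound′ (suc m) (suc n) r s (+-congʳ one) (+-congʳ one))
    (≈-trans (solve 5 (λ M N r s h →
        ((((con (pos 1) :+ M) :+ r) :* ((con (pos 1) :+ N) :- ((((con (pos 1) :+ M) :+ r) :+ con (pos 1)) :* h))) :+ s) :+ con (pos 1)
        := (((((M :+ r) :* (N :- (((M :+ r) :+ con (pos 1)) :* h))) :+ s) :+ con (pos 1)) :+ N)
           :+ ((M :+ r) :+ con (pos 1)) :* (con (pos 1) :- (h :+ h)))
      ≈-refl (fromℕ m) (fromℕ n) r s ½)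
      (+-congʳ (+-congʳ (≈-sym (bound≈bound′ m n r s ≈-refl ≈-refl))))))

  -- For q = 2t² + κ₁t + κ₂ and T = t + r, substituting t = T - r gives 2 (bound - q) = T (2n - 5t)
  -- - T * `offset` - `deficit`.
  offset : (r κ₁ : Carrier) → Carrier
  offset r κ₁ = (fromℕ 1 -F (fromℕ 3 *F r)) +F (fromℕ 2 *F κ₁)

  deficit : (r s κ₁ κ₂ : Carrier) → Carrier
  deficit r s κ₁ κ₂ = ((((fromℕ 4 *F (r *F r)) -F (fromℕ 2 *F (κ₁ *F r))) +F (fromℕ 2 *F κ₂)) -F (fromℕ 2 *F s)) -F fromℕ 2

  -- With T = t + r, the difference 2 (bound - q) equals
  -- T (2n - 5t - 2g) + T g + (T - ½) (g - offset) + ½ (g - offset - 2 deficit).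
  quadratic≤bound : ∀ t n g q c₁ c₂ r s →
    q ≤ 2 * (t * t) + c₁ * t + c₂ → 5 * t + 2 * g ≤ 2 * n → ½ ≤F (fromℕ t +F r) →
    offset r (fromℕ c₁) ≤F fromℕ g →
    (offset r (fromℕ c₁) +F (fromℕ 2 *F deficit r s (fromℕ c₁) (fromℕ c₂))) ≤F fromℕ g →
    fromℕ q ≤F bound F t n r s
  quadratic≤bound t n g q c₁ c₂ r s q≤ n≥ T≥½ g≥₁ g≥₂ =
    ≤-trans (fromℕ-mono q≤) (≤-respˡ (≈-sym quadratic) (≤-respʳ (≈-sym (bound≈bound′ t n r s ≈-refl ≈-refl))
      (double-cancel-≤ (0≤-⇒≤ (≤-respʳ (≈-sym difference) nonneg)))))
    where
    τ ν γ κ₁ κ₂ T A B : Carrier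
    τ  = fromℕ t
    ν  = fromℕ n
    γ  = fromℕ g
    κ₁ = fromℕ c₁
    κ₂ = fromℕ c₂
    T  = τ +F r
    A  = offset r κ₁
    B  = deficit r s κ₁ κ₂
    quadratic : fromℕ (2 * (t * t) + c₁ * t + c₂) ≈ (((fromℕ 2 *F (τ *F τ)) +F (κ₁ *F τ)) +F κ₂)
    quadratic = ≈-trans (fromℕ-+ (2 * (t * t) + c₁ * t) c₂) (+-congʳ (≈-trans (fromℕ-+ (2 * (t * t)) (c₁ * t))
      (+-cong (≈-trans (fromℕ-* 2 (t * t)) (*-congˡ (fromℕ-* t t))) (fromℕ-* c₁ t))))
    T≥0 : 0F ≤F T
    T≥0 = ≤-trans 0≤½ T≥½
    slack : 0F ≤F ((fromℕ 2 *F ν) -F ((fromℕ 5 *F τ) +F (fromℕ 2 *F γ)))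
    slack = ≤⇒0≤- (≤-respʳ (fromℕ-* 2 n) (≤-respˡ (≈-trans (fromℕ-+ (5 * t) (2 * g)) (+-cong (fromℕ-* 5 t) (fromℕ-* 2 g))) (fromℕ-mono n≥)))
    surplus : Carrier
    surplus = (((T *F ((fromℕ 2 *F ν) -F ((fromℕ 5 *F τ) +F (fromℕ 2 *F γ)))) +F (T *F γ)) +F ((T -F ½) *F (γ -F A)))
              +F (½ *F (γ -F (A +F (fromℕ 2 *F B))))
    nonneg : 0F ≤F surplus
    nonneg = +-nonneg (+-nonneg (+-nonneg (*-nonneg T≥0 slack) (*-nonneg T≥0 (fromℕ-nonneg g)))
                                (*-nonneg (≤⇒0≤- T≥½) (≤⇒0≤- g≥₁)))
                      (*-nonneg 0≤½ (≤⇒0≤- g≥₂))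
    difference : ((bound′ τ ν r s +F bound′ τ ν r s) -F
                  ((((fromℕ 2 *F (τ *F τ)) +F (κ₁ *F τ)) +F κ₂) +F (((fromℕ 2 *F (τ *F τ)) +F (κ₁ *F τ)) +F κ₂))) ≈ surplus
    difference = drop-vanish surplus ((T *F (T +F fromℕ 1)) -F B)
      (solve 8 (λ τ ν γ κ₁ κ₂ r s h →
         let T = τ :+ r
             A = (con (pos 1) :- (con (pos 3) :* r)) :+ (con (pos 2) :* κ₁)
             B = ((((con (pos 4) :* (r :* r)) :- (con (pos 2) :* (κ₁ :* r))) :+ (con (pos 2) :* κ₂)) :- (con (pos 2) :* s)) :- con (pos 2)
             b = ((T :* (ν :- ((T :+ con (pos 1)) :* h))) :+ s) :+ con (pos 1)
             p = ((con (pos 2) :* (τ :* τ)) :+ (κ₁ :* τ)) :+ κ₂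
         in (b :+ b) :- (p :+ p) :=
            ((((T :* ((con (pos 2) :* ν) :- ((con (pos 5) :* τ) :+ (con (pos 2) :* γ)))) :+ (T :* γ)) :+ ((T :- h) :* (γ :- A)))
              :+ (h :* (γ :- (A :+ (con (pos 2) :* B)))))
            :+ (((T :* (T :+ con (pos 1))) :- B) :* (con (pos 1) :- (h :+ h))))
       ≈-refl τ ν γ κ₁ κ₂ r s ½)

  -- Here T = t + r is at most -½. Twice the bound, plus (-½ - T)(2n + 1), T², the slack in the
  -- assumption on n, and ½, adds up to -1. All these terms other than the bound are nonnegative.
  bound-negative : ∀ t n r s → (fromℕ (suc t) +F r) ≤F ½ → ((fromℕ 2 *F s) +F fromℕ 4) ≤F fromℕ (suc n) →
                   ¬ (0F ≤F bound F t (suc n) r s)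
  bound-negative t n r s T≤½ n≥ 0≤b = 1≰0 (≤-respˡ (≈-sym one) (0≤-⇒≤ (≤-respʳ difference nonneg)))
    where
    τ N d U b : Carrier
    τ = fromℕ t
    N = fromℕ n
    d = ½ -F ((fromℕ 1 +F τ) +F r)
    U = d +F ½
    b = bound′ τ (fromℕ 1 +F N) r s
    d≥0 : 0F ≤F d
    d≥0 = ≤⇒0≤- (≤-respˡ (+-congʳ (+-congʳ one)) T≤½)
    U≥0 : 0F ≤F U
    U≥0 = +-nonneg d≥0 0≤½
    b≥0 : 0F ≤F b
    b≥0 = ≤-respʳ (bound≈bound′ t (suc n) r s ≈-refl (+-congʳ one)) 0≤b
    total-sum : Carrier
    total-sum = ((((b +F b) +F (d *F (fromℕ 1 +F (N +F N)))) +F (U *F U)) +F ((fromℕ 1 +F N) -F ((fromℕ 2 *F s) +F fromℕ 4))) +F ½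
    nonneg : 0F ≤F total-sum
    nonneg = +-nonneg (+-nonneg (+-nonneg (+-nonneg (+-nonneg b≥0 b≥0)
        (*-nonneg d≥0 (+-nonneg (fromℕ-nonneg 1) (+-nonneg (fromℕ-nonneg n) (fromℕ-nonneg n)))))
        (*-nonneg U≥0 U≥0)) (≤⇒0≤- (≤-respʳ (+-congʳ one) n≥))) 0≤½
    difference : total-sum ≈ (0F -F fromℕ 1)
    difference = drop-vanish _ ((((τ +F r) *F (τ +F r)) +F (fromℕ 3 *F (τ +F r))) +F ((fromℕ 1 -F (½ +F ½)) -F (fromℕ 1 +F N)))
      (solve 5 (λ τ N r s h →
         let T = τ :+ r
             b = ((T :* ((con (pos 1) :+ N) :- ((T :+ con (pos 1)) :* h))) :+ s) :+ con (pos 1)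
             d = h :- ((con (pos 1) :+ τ) :+ r)
             U = d :+ h
         in ((((b :+ b) :+ (d :* (con (pos 1) :+ (N :+ N)))) :+ (U :* U)) :+ ((con (pos 1) :+ N) :- ((con (pos 2) :* s) :+ con (pos 4)))) :+ h
            := (con (pos 0) :- con (pos 1)) :+ ((((T :* T) :+ (con (pos 3) :* T)) :+ ((con (pos 1) :- (h :+ h)) :- (con (pos 1) :+ N))) :* (con (pos 1) :- (h :+ h))))
       ≈-refl τ N r s ½)

  double-fromℕ : ∀ n → fromℕ (2 * n) ≈ (fromℕ n +F fromℕ n)
  double-fromℕ n = ≈-trans (fromℕ-* 2 n) (solve 1 (λ x → con (pos 2) :* x := x :+ x) ≈-refl (fromℕ n))

  double-threshold : ∀ τ γ → ((fromℕ 5 *F τ) +F (fromℕ 2 *F γ)) ≈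
                     ((((fromℕ 5 *F ½) *F τ) +F γ) +F (((fromℕ 5 *F ½) *F τ) +F γ))
  double-threshold τ γ = ≈-sym (drop-vanish _ (-F (fromℕ 5 *F τ))
    (solve 3 (λ τ γ h → (((con (pos 5) :* h) :* τ) :+ γ) :+ (((con (pos 5) :* h) :* τ) :+ γ)
                := ((con (pos 5) :* τ) :+ (con (pos 2) :* γ)) :+ ((:- (con (pos 5) :* τ)) :* (con (pos 1) :- (h :+ h))))
       ≈-refl τ γ ½))

-- Comparing anti-Ramsey numbers with the bound

-- Read off by expanding `stepBound L m` in powers of m.
linearCoeff constantCoeff : Graph → ℕ
linearCoeff L   = 3 * size L + 8
constantCoeff L = size L * size L + size L * size L + size L + 1

-- The step arrives at t = m + 1, so the polynomial is weakened to that argument to fit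
-- `quadratic≤bound`.
stepBound-quadratic : ∀ L m → stepBound L m ≤ 2 * (suc m * suc m) + linearCoeff L * suc m + constantCoeff L
stepBound-quadratic L m = begin
  stepBound L m                                                        ≡⟨ expand (size L) m ⟩
  2 * (m * m) + linearCoeff L * m + constantCoeff L                    ≤⟨ +-monoˡ-≤ (constantCoeff L) (ℕₚ.+-mono-≤ (*-monoʳ-≤ 2 (*-mono-≤ (n≤1+n m) (n≤1+n m))) (*-monoʳ-≤ (linearCoeff L) (n≤1+n m))) ⟩
  2 * (suc m * suc m) + linearCoeff L * suc m + constantCoeff L        ∎
  where
  open ≤-Reasoning
  expand : ∀ ℓ m → 1 + (ℓ * ℓ + m + ℓ * (ℓ + 2 * m + 1) + (ℓ + 1) * m + 2 * (m * m) + 6 * m)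
         ≡ 2 * (m * m) + (3 * ℓ + 8) * m + (ℓ * ℓ + ℓ * ℓ + ℓ + 1)
  expand = solve-∀

AR-step : ∀ L m {n a b} → 2 ≤ n → IsAR n (L ∪G matching m) a → IsAR (suc n) (L ∪G matching (suc m)) b →
          b ≤ a + n ⊎ b ≤ stepBound L m
AR-step L m {n} {a} {b} 2≤n (forces , _) (_ , minimal) with ⊔-sel (a + n) (stepBound L m)
... | inj₁ e = inj₁ (subst (b ≤_) e (minimal _ (forces-step L m 2≤n forces)))
... | inj₂ e = inj₂ (subst (b ≤_) e (minimal _ (forces-step L m 2≤n forces)))

module _ {c ℓ₁ ℓ₂} (F : OrderedField c ℓ₁ ℓ₂) where

  open OrderedField F hiding (+-mono-≤)
  open OrderedFieldProperties F
  open CommutativeRing commutativeRing using (+-cong) renaming (sym to ≈-sym; trans to ≈-trans)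
  open IsTotalOrder isTotalOrder using () renaming (trans to ≤F-trans)

  hypothesis-fails : Archimedean F → ∀ L t₁ n₀ r s →
    (∀ n → n₀ ≤ n → ARAtMost F n (L ∪G matching t₁) (bound F t₁ n r s)) →
    ¬ ((fromℕ (suc t₁) +F r) ≤F ½)
  hypothesis-fails arch L t₁ n₀ r s hyp T≤½ with arch ((fromℕ 2 *F s) +F fromℕ 4)
  ... | k , k≥ with AR-exists (suc (n₀ + k)) (L ∪G matching t₁)
  ...   | a , isAR = bound-negative t₁ (n₀ + k) r s T≤½
          (≤F-trans k≥ (fromℕ-mono (ℕₚ.≤-trans (m≤n+m k n₀) (n≤1+n _))))
          (≤F-trans (fromℕ-nonneg a) (hyp _ (ℕₚ.≤-trans (m≤m+n n₀ k) (n≤1+n _)) a isAR))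

  module _ (L : Graph) (t₁ n₀ : ℕ) (r s : Carrier)
           (hyp : ∀ n → n₀ ≤ n → ARAtMost F n (L ∪G matching t₁) (bound F t₁ n r s))
           (½≤ : ½ ≤F (fromℕ (suc t₁) +F r))
           (g : ℕ) (n₀≤g : n₀ ≤ g) (3≤g : 3 ≤ g)
           (offset≤ : offset r (fromℕ (linearCoeff L)) ≤F fromℕ g)
           (deficit≤ : (offset r (fromℕ (linearCoeff L)) +F
                        (fromℕ 2 *F deficit r s (fromℕ (linearCoeff L)) (fromℕ (constantCoeff L)))) ≤F fromℕ g) where

    g≤n : ∀ t {n} → 5 * t + 2 * g ≤ 2 * n → g ≤ n
    g≤n t h = *-cancelˡ-≤ 2 (ℕₚ.≤-trans (m≤n+m (2 * g) (5 * t)) h)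

    -- Induction on d = t - t₁, with n decreasing alongside. The base case is the hypothesis,
    -- available because n ≥ g ≥ n₀; g ≥ 3 leaves at least two vertices after a deletion. The second
    -- alternative of `AR-step` needs no induction.
    AR-bound : ∀ d n → 5 * (d + t₁) + 2 * g ≤ 2 * n → ARAtMost F n (L ∪G matching (d + t₁)) (bound F (d + t₁) n r s)
    AR-bound zero n n≥ = hyp n (ℕₚ.≤-trans n₀≤g (g≤n t₁ n≥))
    AR-bound (suc d) zero n≥ with ℕₚ.≤-trans 3≤g (g≤n (suc d + t₁) {0} n≥)
    ... | ()
    AR-bound (suc d) (suc n) n≥ b isARb with AR-exists n (L ∪G matching (d + t₁))
    ... | a , isARa with AR-step L (d + t₁) (s≤s⁻¹ (ℕₚ.≤-trans 3≤g (g≤n (suc d + t₁) n≥))) isARa isARb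
    ...   | inj₁ b≤ = ≤F-trans (fromℕ-mono b≤) (≤-respˡ (≈-sym (fromℕ-+ a n)) (≤-respʳ (≈-sym (bound-suc (d + t₁) n r s))
                        (OrderedField.+-mono-≤ F (fromℕ n) (AR-bound d n descend a isARa))))
      where
      shift : ∀ x y → 5 * suc x + 2 * y ≡ 5 + (5 * x + 2 * y)
      shift = solve-∀
      double-suc : ∀ x → 2 * suc x ≡ 2 + 2 * x
      double-suc = solve-∀
      -- Lowering t and n by one takes 5 from the left side and only 2 from the right.
      descend : 5 * (d + t₁) + 2 * g ≤ 2 * n
      descend = +-cancelˡ-≤ 2 _ _ (ℕₚ.≤-trans (+-monoˡ-≤ (5 * (d + t₁) + 2 * g) {2} {5} (s≤s (s≤s z≤n)))
        (ℕₚ.≤-trans (ℕₚ.≤-reflexive (≡-sym (shift (d + t₁) g))) (ℕₚ.≤-trans n≥ (ℕₚ.≤-reflexive (double-suc n)))))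
    ...   | inj₂ b≤ = ≤F-trans (fromℕ-mono b≤)
        (quadratic≤bound (suc (d + t₁)) (suc n) g (stepBound L (d + t₁)) (linearCoeff L) (constantCoeff L) r s
          (stepBound-quadratic L (d + t₁)) n≥
          (≤F-trans ½≤ (OrderedField.+-mono-≤ F r (fromℕ-mono (s≤s (m≤n+m t₁ d))))) offset≤ deficit≤)

  -- Doubling clears the ½, so that the induction can compare t and n within ℕ.
  threshold-ℕ : ∀ t g n → (((fromℕ 5 *F ½) *F fromℕ t) +F fromℕ g) ≤F fromℕ n → 5 * t + 2 * g ≤ 2 * n
  threshold-ℕ t g n h = fromℕ-cancel-≤ {5 * t + 2 * g} {2 * n} (≤-respˡ (≈-sym doubled) (≤-respʳ (≈-sym 2n) (+-mono h h)))
    where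
    2n : fromℕ (2 * n) ≈ (fromℕ n +F fromℕ n)
    2n = double-fromℕ n
    doubled : fromℕ (5 * t + 2 * g) ≈ ((((fromℕ 5 *F ½) *F fromℕ t) +F fromℕ g) +F (((fromℕ 5 *F ½) *F fromℕ t) +F fromℕ g))
    doubled = ≈-trans (fromℕ-+ (5 * t) (2 * g)) (≈-trans (+-cong (fromℕ-* 5 t) (fromℕ-* 2 g)) (double-threshold (fromℕ t) (fromℕ g)))

theorem3p1 : ∀ {c ℓ₁ ℓ₂} (F : OrderedField c ℓ₁ ℓ₂) → Archimedean F →
    (L : Graph) (t₁ n₀ : ℕ) → size L + 2 * t₁ ≤ n₀ →
    (r s : OrderedField.Carrier F) →
    (∀ n → n₀ ≤ n → ARAtMost F n (L ∪G matching t₁) (bound F t₁ n r s)) →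
    Σ (OrderedField.Carrier F) λ γ₂ →
    ∀ t n → t₁ ≤ t →
    OrderedField._<F_ F
    (OrderedField._+F_ F
    (OrderedField._*F_ F (OrderedField._*F_ F (OrderedField.fromℕ F 5) (OrderedField.½ F))
    (OrderedField.fromℕ F t))
    γ₂)
    (OrderedField.fromℕ F n) →
    ARAtMost F n (L ∪G matching t) (bound F t n r s)
theorem3p1 F arch L t₁ n₀ _ r s hyp =
  fromℕ g , λ t n t₁≤t n> → conclude t n t₁≤t (threshold-ℕ F t g n (proj₁ n>))
  where
  open OrderedField F
  open OrderedFieldProperties F
  open IsTotalOrder isTotalOrder using (total) renaming (trans to ≤F-trans)
  α β : Carrier
  α = offset r (fromℕ (linearCoeff L))
  β = α +F (fromℕ 2 *F deficit r s (fromℕ (linearCoeff L)) (fromℕ (constantCoeff L)))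
  g₁ g₂ g : ℕ
  g₁ = proj₁ (arch α)
  g₂ = proj₁ (arch β)
  -- The summands provide, in order, the range of the hypothesis, two vertices after a deletion, and
  -- the two field inequalities of `quadratic≤bound`. None depends on t or n.
  g = (n₀ + 3) + (g₁ + g₂)
  conclude : ∀ t n → t₁ ≤ t → 5 * t + 2 * g ≤ 2 * n → ARAtMost F n (L ∪G matching t) (bound F t n r s)
  -- The dichotomy is taken at t₁ + 1, the least t for which the bound is compared with the
  -- quadratic.
  conclude t n t₁≤t n≥ with total ½ (fromℕ (suc t₁) +F r) | m≤n⇒∃[o]m+o≡n t₁≤t
  ... | inj₂ T≤½ | _ = contradiction T≤½ (hypothesis-fails F arch L t₁ n₀ r s hyp)
  ... | inj₁ ½≤T | d , e with trans (≡-sym e) (ℕₚ.+-comm t₁ d)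
  ...   | refl = AR-bound F L t₁ n₀ r s hyp ½≤T g
    (ℕₚ.≤-trans (m≤m+n n₀ 3) (m≤m+n _ _))
    (ℕₚ.≤-trans (m≤n+m 3 n₀) (m≤m+n _ _))
    (≤F-trans (proj₂ (arch α)) (fromℕ-mono (ℕₚ.≤-trans (m≤m+n g₁ g₂) (m≤n+m _ (n₀ + 3)))))
    (≤F-trans (proj₂ (arch β)) (fromℕ-mono (ℕₚ.≤-trans (m≤n+m g₂ g₁) (m≤n+m _ (n₀ + 3)))))
    d n n≥
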